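{- Let $r$ be a positive integer, let $F:\mathbf{Set}^r\to\mathbf{Set}$ be an $r$-sort species and let $\eta:F\times F\to F\circ\amalg$ be a natural transformation. Suppose $F$ is decomposable and $\eta$ is a composition operator for $F$. Let $\Lambda$ be a commutative ring containing $\mathbb{Q}$ and let $w$ be a $\Lambda$-weight on $(F,\eta)$. Then \[ \mathrm{GF}_F(z_1,\dots,z_r)=\exp\big(\mathrm{GF}_{F_\eta}(z_1,\dots,z_r)\big) \] as formal power series over $\Lambda$.
   Context: $\mathbf{Set}$ is the category of finite sets and bijections, and $\mathbf{Set}^r$ is its $r$-fold product. An object $\Omega=(\Omega^{(1)},\dots,\Omega^{(r)})$ of $\mathbf{Set}^r$ is an $r$-tuple of finite sets. The set operations $\cap,\cup,-,\amalg,\subseteq$ on such tuples are taken componentwise, and $\boldsymbol{\emptyset}=(\emptyset,\dots,\emptyset)$. $\mathfrak{D}_r$ is the full subcategory of $\mathbf{Set}^r\times\mathbf{Set}^r$ whose objects are the pairs $(\Omega_1,\Omega_2)$ with $\Omega_1\cap\Omega_2=\boldsymbol{\emptyset}$. An $r$-sort species is a functor $F:\mathbf{Set}^r\to\mathbf{Set}$. A natural transformation $\eta:F\times F\to F\circ\amalg$ is a family of injective maps $\eta_{(\Omega_1,\Omega_2)}:F[\Omega_1]\times F[\Omega_2]\to F[\Omega_1\amalg\Omega_2]$, one for each $(\Omega_1,\Omega_2)\in\mathfrak{D}_r$, satisfying the following naturality condition: for all morphisms (tuples of bijections) $f_i:\Omega_i\to\tilde\Omega_i$, $i=1,2$, with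 $(\Omega_1,\Omega_2),(\tilde\Omega_1,\tilde\Omega_2)\in\mathfrak{D}_r$, \[ \eta_{(\tilde\Omega_1,\tilde\Omega_2)}\circ(F[f_1]\times F[f_2])=F[f_1\amalg f_2]\circ\eta_{(\Omega_1,\Omega_2)}. \] For subsets $A\subseteq F[\Omega_1]$ and $B\subseteq F[\Omega_2]$, $\eta(A\times B)$ denotes the image $\eta_{(\Omega_1,\Omega_2)}(A\times B)$; indices are suppressed. Such an $\eta$ is a composition operator for $F$ if it satisfies axiom (D1): for every $\Omega$ and all $(\Omega_1,\Omega_2),(\tilde\Omega_1,\tilde\Omega_2)\in\mathfrak{D}_r$ with $\Omega_1\amalg\Omega_2=\Omega=\tilde\Omega_1\amalg\tilde\Omega_2$, \[ \eta(F[\Omega_1]\times F[\Omega_2])\cap\eta(F[\tilde\Omega_1]\times F[\tilde\Omega_2])=\eta\big(\eta(F[\Omega_{11}]\times F[\Omega_{12}])\times\eta(F[\Omega_{21}]\times F[\Omega_{22}])\big), \] where $\Omega_{ij}=\Omega_i\cap\tilde\Omega_j$. $F$ is decomposable if $F[\Omega]\neq\emptyset$ for some $\Omega$ and $F$ admits some composition operator. The indecomposables are defined by $F_\eta[\boldsymbol\emptyset]=\emptyset$ and, for $\Omega\ne\boldsymbol\emptyset$, \[ F_\eta[\Omega]=F[\Omega]-\bigcup\eta(F[I]\times F[J]), \] the union running over all $(I,J)\in\mathfrak{D}_r$ with $I\amalg J=\Omega$ and $I\ne\boldsymbol\emptyset\ne J$. A $\Lambda$-weight on $(F,\eta)$ is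 a family of maps $w_\Omega:F[\Omega]\to\Lambda$ satisfying: (W0) $w_{\boldsymbol\emptyset}(x)=1$ for all $x\in F[\boldsymbol\emptyset]$; (W1) $w_{\Omega_2}(F[f](x))=w_{\Omega_1}(x)$ for every morphism $f:\Omega_1\to\Omega_2$ and every $x\in F[\Omega_1]$; (W2) $w_{\Omega_1\amalg\Omega_2}(\eta_{(\Omega_1,\Omega_2)}(x_1,x_2))=w_{\Omega_1}(x_1)\,w_{\Omega_2}(x_2)$ for all $(\Omega_1,\Omega_2)\in\mathfrak{D}_r$, $x_1\in F_\eta[\Omega_1]$ and $x_2\in F[\Omega_2]$. With $[n]=\{1,\dots,n\}$, \[ \mathrm{GF}_F=\sum_{n_1,\dots,n_r\ge0}\ \sum_{x\in F[([n_1],\dots,[n_r])]}w(x)\,\frac{z_1^{n_1}\cdots z_r^{n_r}}{n_1!\cdots n_r!}, \] and $\mathrm{GF}_{F_\eta}$ is defined in the same way with $F_\eta$ in place of $F$. -}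

module Defs where

open import Level using (Level; _⊔_) renaming (suc to lsuc; zero to lzero)
open import Data.Bool using (Bool; true; false; _∨_; _∧_; not; if_then_else_; T)
open import Data.Nat using (ℕ; zero; suc; _∸_) renaming (_+_ to _+ℕ_)
open import Data.Nat.Base using (_!)
open import Data.Nat.Properties using (_!≢0)
open import Data.Fin using (Fin)
import Data.List
open import Data.List using (List; []; _∷_; _++_; [_]; replicate; concatMap; upTo; foldr)
open import Data.Maybe using (Maybe; just; nothing)
open import Data.Vec using (Vec; lookup; zipWith; map) renaming ([] to []ᵥ; _∷_ to _∷ᵥ_; replicate to replicateᵥ)
open import Data.Product using (Σ; Σ-syntax; _×_; _,_; proj₁; proj₂)
open import Data.Integer using (+_)
open import Data.Rational using (ℚ; _/_)
open import Function.Bundles using (_↔_; Inverse)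
open import Function.Properties.Inverse using (↔-refl; ↔-trans)
open import Relation.Binary.PropositionalEquality using (_≡_; _≢_; subst)
open import Relation.Nullary using (¬_)
open import Algebra.Bundles using (CommutativeRing)

-- Finite sets of labels: canonical finite subsets of ℕ.
-- `nothing` is ∅; `just bs` is the set whose characteristic bit list
-- is `bs ++ [ true ]` (bit i says whether i is a member).  Every finite
-- subset of ℕ has exactly one representation.

FinSet : Set
FinSet = Maybe (List Bool)

toBits : FinSet → List Bool
toBits nothing   = []
toBits (just bs) = bs ++ [ true ]

fromBits : List Bool → FinSet
fromBits []       = nothing
fromBits (b ∷ bs) with fromBits bs
... | nothing = if b then just [] else nothing
... | just cs = just (b ∷ cs)

zipPad : (Bool → Bool → Bool) → List Bool → List Bool → List Bool
zipPad op []       []       = []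
zipPad op []       (b ∷ bs) = op false b ∷ zipPad op [] bs
zipPad op (a ∷ as) []       = op a false ∷ zipPad op as []
zipPad op (a ∷ as) (b ∷ bs) = op a b ∷ zipPad op as bs

bitAt : List Bool → ℕ → Bool
bitAt []       _       = false
bitAt (b ∷ bs) zero    = b
bitAt (b ∷ bs) (suc n) = bitAt bs n

_∈?_ : ℕ → FinSet → Bool
n ∈? A = bitAt (toBits A) n

_∪ₛ_ _∩ₛ_ _−ₛ_ : FinSet → FinSet → FinSet
A ∪ₛ B = fromBits (zipPad _∨_ (toBits A) (toBits B))
A ∩ₛ B = fromBits (zipPad _∧_ (toBits A) (toBits B))
A −ₛ B = fromBits (zipPad (λ a b → a ∧ not b) (toBits A) (toBits B))

El : FinSet → Set
El A = Σ ℕ (λ n → T (n ∈? A))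

-- [n] = {1,…,n}
⟦_⟧ : ℕ → FinSet
⟦ n ⟧ = fromBits (false ∷ replicate n true)

Obj : ℕ → Set
Obj r = Vec FinSet r

module _ {r : ℕ} where

  ∅ᵣ : Obj r
  ∅ᵣ = replicateᵥ r nothing

  infixl 6 _∪_ _−_
  infixl 7 _∩_
  _∪_ _∩_ _−_ : Obj r → Obj r → Obj r
  _∪_ = zipWith _∪ₛ_
  _∩_ = zipWith _∩ₛ_
  _−_ = zipWith _−ₛ_

  Disjoint : Obj r → Obj r → Set
  Disjoint Ω₁ Ω₂ = Ω₁ ∩ Ω₂ ≡ ∅ᵣ

  record Hom (Ω Ω' : Obj r) : Set where
    constructor hom
    field
      comp : (i : Fin r) → El (lookup Ω i) ↔ El (lookup Ω' i)
  open Hom public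

  idHom : (Ω : Obj r) → Hom Ω Ω
  idHom Ω = hom (λ i → ↔-refl)

  _∘H_ : ∀ {Ω Ω' Ω''} → Hom Ω' Ω'' → Hom Ω Ω' → Hom Ω Ω''
  g ∘H f = hom (λ i → ↔-trans (comp f i) (comp g i))

  _≈H_ : ∀ {Ω Ω'} → Hom Ω Ω' → Hom Ω Ω' → Set
  f ≈H g = ∀ i x → Inverse.to (comp f i) x ≡ Inverse.to (comp g i) x

  IsCoproduct : ∀ {Ω₁ Ω₂ Ω̃₁ Ω̃₂} → Hom Ω₁ Ω̃₁ → Hom Ω₂ Ω̃₂ →
                Hom (Ω₁ ∪ Ω₂) (Ω̃₁ ∪ Ω̃₂) → Set
  IsCoproduct {Ω₁} {Ω₂} f₁ f₂ g =
    (∀ i (y : El (lookup (Ω₁ ∪ Ω₂) i)) (x : El (lookup Ω₁ i)) → proj₁ y ≡ proj₁ x →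
       proj₁ (Inverse.to (comp g i) y) ≡ proj₁ (Inverse.to (comp f₁ i) x)) ×
    (∀ i (y : El (lookup (Ω₁ ∪ Ω₂) i)) (x : El (lookup Ω₂ i)) → proj₁ y ≡ proj₁ x →
       proj₁ (Inverse.to (comp g i) y) ≡ proj₁ (Inverse.to (comp f₂ i) x))

record Species (r : ℕ) : Set₁ where
  field
    F₀     : Obj r → Set
    F₁     : ∀ {Ω Ω'} → Hom Ω Ω' → F₀ Ω → F₀ Ω'
    F-id   : ∀ {Ω} (x : F₀ Ω) → F₁ (idHom Ω) x ≡ x
    F-∘    : ∀ {Ω Ω' Ω''} (g : Hom Ω' Ω'') (f : Hom Ω Ω') (x : F₀ Ω) →
             F₁ (g ∘H f) x ≡ F₁ g (F₁ f x)
    F-cong : ∀ {Ω Ω'} {f g : Hom Ω Ω'} → f ≈H g → ∀ x → F₁ f x ≡ F₁ g x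
    card   : Obj r → ℕ
    enum   : ∀ Ω → F₀ Ω ↔ Fin (card Ω)

record NatTrans {r : ℕ} (S : Species r) : Set where
  open Species S
  field
    η       : ∀ Ω₁ Ω₂ .(d : Disjoint Ω₁ Ω₂) → F₀ Ω₁ → F₀ Ω₂ → F₀ (Ω₁ ∪ Ω₂)
    η-inj   : ∀ {Ω₁ Ω₂} .(d : Disjoint Ω₁ Ω₂) (a a' : F₀ Ω₁) (b b' : F₀ Ω₂) →
              η Ω₁ Ω₂ d a b ≡ η Ω₁ Ω₂ d a' b' → (a ≡ a') × (b ≡ b')
    natural : ∀ {Ω₁ Ω₂ Ω̃₁ Ω̃₂} .(d : Disjoint Ω₁ Ω₂) .(d̃ : Disjoint Ω̃₁ Ω̃₂)
              (f₁ : Hom Ω₁ Ω̃₁) (f₂ : Hom Ω₂ Ω̃₂) (g : Hom (Ω₁ ∪ Ω₂) (Ω̃₁ ∪ Ω̃₂)) →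
              IsCoproduct f₁ f₂ g →
              ∀ a b → η Ω̃₁ Ω̃₂ d̃ (F₁ f₁ a) (F₁ f₂ b) ≡ F₁ g (η Ω₁ Ω₂ d a b)

module _ {r : ℕ} {S : Species r} (N : NatTrans S) where
  open Species S
  open NatTrans N

  InImage : ∀ Ω₁ Ω₂ .(d : Disjoint Ω₁ Ω₂) → F₀ (Ω₁ ∪ Ω₂) → Set
  InImage Ω₁ Ω₂ d x = Σ[ a ∈ F₀ Ω₁ ] Σ[ b ∈ F₀ Ω₂ ] η Ω₁ Ω₂ d a b ≡ x

  IsCompositionOperator : Set
  IsCompositionOperator =
    ∀ (Ω₁ Ω₂ Ω̃₁ Ω̃₂ : Obj r) .(d : Disjoint Ω₁ Ω₂) .(d̃ : Disjoint Ω̃₁ Ω̃₂)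
      (p : Ω₁ ∪ Ω₂ ≡ Ω̃₁ ∪ Ω̃₂)
      .(d₁ : Disjoint (Ω₁ ∩ Ω̃₁) (Ω₁ ∩ Ω̃₂))
      .(d₂ : Disjoint (Ω₂ ∩ Ω̃₁) (Ω₂ ∩ Ω̃₂))
      .(d₁₂ : Disjoint ((Ω₁ ∩ Ω̃₁) ∪ (Ω₁ ∩ Ω̃₂)) ((Ω₂ ∩ Ω̃₁) ∪ (Ω₂ ∩ Ω̃₂)))
      (q : ((Ω₁ ∩ Ω̃₁) ∪ (Ω₁ ∩ Ω̃₂)) ∪ ((Ω₂ ∩ Ω̃₁) ∪ (Ω₂ ∩ Ω̃₂)) ≡ Ω₁ ∪ Ω₂)
      (x : F₀ (Ω₁ ∪ Ω₂)) →
      let RHS = Σ[ a ∈ F₀ (Ω₁ ∩ Ω̃₁) ] Σ[ b ∈ F₀ (Ω₁ ∩ Ω̃₂) ]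
                Σ[ c ∈ F₀ (Ω₂ ∩ Ω̃₁) ] Σ[ e ∈ F₀ (Ω₂ ∩ Ω̃₂) ]
                subst F₀ q (η _ _ d₁₂ (η (Ω₁ ∩ Ω̃₁) (Ω₁ ∩ Ω̃₂) d₁ a b)
                                      (η (Ω₂ ∩ Ω̃₁) (Ω₂ ∩ Ω̃₂) d₂ c e)) ≡ x
      in ((InImage Ω₁ Ω₂ d x × InImage Ω̃₁ Ω̃₂ d̃ (subst F₀ p x)) → RHS) ×
         (RHS → (InImage Ω₁ Ω₂ d x × InImage Ω̃₁ Ω̃₂ d̃ (subst F₀ p x)))

  IsIndecomposable : (Ω : Obj r) → F₀ Ω → Set
  IsIndecomposable Ω x =
    (Ω ≢ ∅ᵣ) ×
    ¬ (Σ[ I ∈ Obj r ] Σ[ J ∈ Obj r ] Σ[ d ∈ Disjoint I J ] Σ[ p ∈ I ∪ J ≡ Ω ]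
         (I ≢ ∅ᵣ) × (J ≢ ∅ᵣ) ×
         (Σ[ a ∈ F₀ I ] Σ[ b ∈ F₀ J ] subst F₀ p (η I J d a b) ≡ x))

Decomposable : {r : ℕ} → Species r → Set
Decomposable {r} S =
  (Σ[ Ω ∈ Obj r ] Species.F₀ S Ω) ×
  (Σ[ N ∈ NatTrans S ] IsCompositionOperator N)

record Weight {r : ℕ} {S : Species r} (N : NatTrans S)
              {c ℓ : Level} (Λ : CommutativeRing c ℓ) : Set (c ⊔ ℓ) where
  open Species S
  open NatTrans N
  open CommutativeRing Λ
  field
    w  : (Ω : Obj r) → F₀ Ω → Carrier
    W0 : ∀ (x : F₀ ∅ᵣ) → w ∅ᵣ x ≈ 1#
    W1 : ∀ {Ω₁ Ω₂} (f : Hom Ω₁ Ω₂) (x : F₀ Ω₁) → w Ω₂ (F₁ f x) ≈ w Ω₁ x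
    W2 : ∀ {Ω₁ Ω₂} .(d : Disjoint Ω₁ Ω₂) (x₁ : F₀ Ω₁) (x₂ : F₀ Ω₂) →
         IsIndecomposable N Ω₁ x₁ →
         w (Ω₁ ∪ Ω₂) (η Ω₁ Ω₂ d x₁ x₂) ≈ w Ω₁ x₁ * w Ω₂ x₂

module PowerSeries {c ℓ : Level} (Λ : CommutativeRing c ℓ) (ι : ℚ → CommutativeRing.Carrier Λ) where
  open CommutativeRing Λ

  PS : ℕ → Set c
  PS r = Vec ℕ r → Carrier

  _≈PS_ : ∀ {r} → PS r → PS r → Set ℓ
  f ≈PS g = ∀ n → f n ≈ g n

  ΣL : List Carrier → Carrier
  ΣL = foldr _+_ 0#

  below : ∀ {r} → Vec ℕ r → List (Vec ℕ r)
  below []ᵥ       = []ᵥ ∷ []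
  below (k ∷ᵥ ks) = concatMap (λ j → Data.List.map (j ∷ᵥ_) (below ks)) (upTo (suc k))

  _·_ : ∀ {r} → PS r → PS r → PS r
  (f · g) n = ΣL (Data.List.map (λ m → f m * g (zipWith _∸_ n m)) (below n))

  isZero : ∀ {r} → Vec ℕ r → Bool
  isZero []ᵥ            = true
  isZero (zero ∷ᵥ ns)   = isZero ns
  isZero (suc _ ∷ᵥ _)   = false

  one : ∀ {r} → PS r
  one n = if isZero n then 1# else 0#

  _^_ : ∀ {r} → PS r → ℕ → PS r
  f ^ zero  = one
  f ^ suc k = f · (f ^ k)

  invFact : ℕ → Carrier
  invFact k = ι (_/_ (+ 1) (k !) ⦃ k !≢0 ⦄)

  total : ∀ {r} → Vec ℕ r → ℕ
  total []ᵥ       = 0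
  total (k ∷ᵥ ks) = k +ℕ total ks

  -- exp g = Σ_k g^k / k!, for g with zero constant term: the coefficient of
  -- z^n only receives contributions from k ≤ n₁+⋯+n_r.
  exp : ∀ {r} → PS r → PS r
  exp g n = ΣL (Data.List.map (λ k → invFact k * (g ^ k) n) (upTo (suc (total n))))

  invMultiFact : ∀ {r} → Vec ℕ r → Carrier
  invMultiFact []ᵥ       = 1#
  invMultiFact (k ∷ᵥ ks) = invFact k * invMultiFact ks

module _ {r : ℕ} {S : Species r} {N : NatTrans S} {c ℓ : Level}
         {Λ : CommutativeRing c ℓ} (ι : ℚ → CommutativeRing.Carrier Λ)
         (W : Weight N Λ) where
  open Species S
  open CommutativeRing Λ
  open Weight W
  open PowerSeries Λ ι

  boxes : Vec ℕ r → Obj r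
  boxes n = map ⟦_⟧ n

  weightedSum : (Ω : Obj r) → (F₀ Ω → Bool) → Carrier
  weightedSum Ω sel =
    ΣL (Data.List.map (λ i → let x = Inverse.from (enum Ω) i in
                             if sel x then w Ω x else 0#)
                      (Data.List.allFin (card Ω)))

  GF : PS r
  GF n = invMultiFact n * weightedSum (boxes n) (λ _ → true)

  -- GF of F_η, where χ is the characteristic function of F_η[Ω] ⊆ F[Ω]
  GFη : (χ : (Ω : Obj r) → F₀ Ω → Bool) → PS r
  GFη χ n = invMultiFact n * weightedSum (boxes n) (χ (boxes n))

{-# OPTIONS --safe #-}

-- Fix x ∈ F[Ω] and call I ⊆ Ω good if x ∈ η(F[I] × F[Ω − I]).  By (D1) the good sets are closed
-- under complement and intersection, so every point of Ω lies in exactly one minimal good set, and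
-- minimality of I means that the F[I]-component of x is indecomposable.  Weighting the pairs
-- (point, structure) by this minimal set gives
--   |Ω| w(F[Ω]) = ∑_{I ⊆ Ω} |I| w(F_η[I]) w(F[Ω − I]),
-- that is, D GF_F = (D GF_{F_η}) GF_F for the Euler operator D = ∑ᵢ zᵢ ∂/∂zᵢ.  Since Λ contains ℚ,
-- this equation and the constant term 1 determine GF_F, and exp GF_{F_η} is also a solution.

module Submission where

open import Defs
open import Level using (Level; _⊔_)
open import Algebra.Bundles using (CommutativeRing)
open import Algebra.Morphism.Structures using (module RingMorphisms)
import Algebra.Properties.CommutativeSemigroup as CommutativeSemigroupProperties
import Algebra.Solver.Ring.NaturalCoefficients.Default as SemiringSolver
open import Data.Bool using (Bool; true; false; not; _∧_; _∨_; T; if_then_else_)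
import Data.Bool.Properties as Boolₚ
open import Data.Empty using (⊥-elim)
open import Data.Fin using (Fin; zero; suc; punchOut)
import Data.Fin.Properties as Finₚ
import Data.Integer as ℤ
open import Data.Integer using (+_)
import Data.Integer.Properties as ℤₚ
import Data.List as List
open import Data.List using (List; []; _∷_; _++_; [_]; length; replicate; concatMap; upTo; applyUpTo; allFin)
open import Data.List.Membership.Propositional using (_∈_)
open import Data.List.Membership.Propositional.Properties using (∈-map⁺; ∈-++⁺ˡ; ∈-++⁺ʳ; ∈-concatMap⁺)
import Data.List.Properties as Listₚ
import Data.List.Relation.Unary.All as All
open import Data.List.Relation.Unary.All using (All; []; _∷_)
import Data.List.Relation.Unary.Any as Any
open import Data.List.Relation.Unary.Any using (here)
open import Data.Maybe using (just; nothing)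
import Data.Maybe.Properties as Maybeₚ
import Data.Nat as ℕ
open import Data.Nat using (ℕ; zero; suc; _≤_; _<_; z≤n; s≤s; _∸_) renaming (_+_ to _+ℕ_)
open import Data.Nat.Base using (_!)
import Data.Nat.Properties as ℕₚ
open import Data.Product using (Σ; Σ-syntax; ∃; _×_; _,_; proj₁; proj₂; uncurry)
import Data.Rational as ℚ
open import Data.Rational using (ℚ; _/_)
import Data.Rational.Properties as ℚₚ
open import Data.Rational.Properties using (+-*-rawRing)
import Data.Rational.Unnormalised as ℚᵘ
import Data.Rational.Unnormalised.Properties as ℚᵘₚ
open import Data.Sum using (_⊎_; inj₁; inj₂)
open import Data.Unit using (⊤; tt)
import Data.Vec as Vec
open import Data.Vec using (Vec; lookup; tabulate; toList; zipWith) renaming ([] to []ᵥ; _∷_ to _∷ᵥ_)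
import Data.Vec.Properties as Vecₚ
open import Function using (_∘_; id)
open import Function.Bundles using (_↔_; Inverse; mk↔ₛ′; _⇔_; Equivalence)
open import Function.Properties.Inverse using (↔-sym; ↔-trans)
open import Relation.Binary.Definitions using (DecidableEquality)
open import Relation.Binary.PropositionalEquality as ≡ using (_≡_; _≢_)
import Relation.Binary.Reasoning.Setoid as SetoidReasoning
open import Relation.Nullary using (¬_; yes; no; Dec)
open import Relation.Nullary.Decidable using (map′; _×-dec_; toWitness; fromWitness; ⌊_⌋)

open CommutativeSemigroupProperties ℕₚ.+-commutativeSemigroup using () renaming (interchange to ℕ-interchange)

-- Power series

-- Closure under complement is not immediate: η need not be symmetric, and F[∅] is not assumed
-- inhabited. (D1), applied to a structure next to a disjoint copy of itself, yields an element of
-- F[∅]. As η is injective and F[Ω] is finite, multiplication by that element permutes F[Ω]. Hence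
-- (∅, Ω) and (Ω, ∅) cut every structure, and with these trivial cuts (D1) gives complements and
-- regroupings. The same injectivity leaves a single element in F[∅], whence the constant term 1. A
-- full factorisation into atoms is never formed: (W2) is multiplicative for an indecomposable left
-- factor, and marking a point splits off exactly one such factor. The point may have any sort, so
-- that the factor |Ω| is nonzero whenever Ω is not ∅ and can be divided out in Λ; a derivative in
-- one variable would lose the terms free of that variable. The sum over I ⊆ Ω becomes a product of
-- series because total weights depend only on the sizes of I and of Ω - I.

suc/1 : ∀ n → + suc n / 1 ≡ ℚ.1ℚ ℚ.+ (+ n / 1)
suc/1 n = ℚₚ.toℚᵘ-injective (ℚᵘₚ.≃-trans (ℚₚ.toℚᵘ-fromℚᵘ (ℚᵘ.mkℚᵘ (+ suc n) 0))
  (ℚᵘₚ.≃-sym (ℚᵘₚ.≃-trans (ℚₚ.toℚᵘ-homo-+ ℚ.1ℚ (+ n / 1))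
    (ℚᵘₚ.≃-trans (ℚᵘₚ.+-congʳ ℚᵘ.1ℚᵘ (ℚₚ.toℚᵘ-fromℚᵘ (ℚᵘ.mkℚᵘ (+ n) 0)))
      (ℚᵘ.*≡* (≡.cong (λ k → (+ 1 ℤ.+ k) ℤ.* + 1) (ℤₚ.*-identityʳ (+ n))))))))

-- Since `_/_` reduces to lowest terms, the equality is checked by cross multiplication of
-- unnormalised fractions. It is used with d = n! for `nat*invFact` and with d = 1 to invert a
-- positive integer.
m/1*1/md : ∀ m d e .{{_ : ℕ.NonZero d}} .{{_ : ℕ.NonZero e}} → e ≡ m ℕ.* d →
           (+ m / 1) ℚ.* (+ 1 / e) ≡ + 1 / d
m/1*1/md m (suc d) (suc e) eq = ℚₚ.toℚᵘ-injective
  (ℚᵘₚ.≃-trans (ℚₚ.toℚᵘ-homo-* (+ m / 1) (+ 1 / suc e))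
    (ℚᵘₚ.≃-trans (ℚᵘₚ.*-cong (ℚₚ.toℚᵘ-fromℚᵘ (ℚᵘ.mkℚᵘ (+ m) 0)) (ℚₚ.toℚᵘ-fromℚᵘ (ℚᵘ.mkℚᵘ (+ 1) e)))
      (ℚᵘₚ.≃-trans (ℚᵘ.*≡* cross) (ℚᵘₚ.≃-sym (ℚₚ.toℚᵘ-fromℚᵘ (ℚᵘ.mkℚᵘ (+ 1) d))))))
  where
  open ≡.≡-Reasoning
  cross : (+ m ℤ.* + 1) ℤ.* + suc d ≡ + 1 ℤ.* + (1 ℕ.* suc e)
  cross = begin
    (+ m ℤ.* + 1) ℤ.* + suc d   ≡⟨ ≡.cong (ℤ._* + suc d) (ℤₚ.*-identityʳ (+ m)) ⟩
    + m ℤ.* + suc d             ≡⟨ ℤₚ.pos-* m (suc d) ⟨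
    + (m ℕ.* suc d)             ≡⟨ ≡.cong +_ eq ⟨
    + suc e                     ≡⟨ ≡.cong +_ (ℕₚ.*-identityˡ (suc e)) ⟨
    + (1 ℕ.* suc e)             ≡⟨ ℤₚ.*-identityˡ _ ⟨
    + 1 ℤ.* + (1 ℕ.* suc e)     ∎

-- Subsets of [n] as bit vectors

ones : List Bool → ℕ
ones []           = 0
ones (true  ∷ bs) = suc (ones bs)
ones (false ∷ bs) = ones bs

allBits : ∀ n → List (Vec Bool n)
allBits zero    = []ᵥ ∷ []
allBits (suc n) = List.map (true ∷ᵥ_) (allBits n) ++ List.map (false ∷ᵥ_) (allBits n)

-- Subobjects of ([n₁],…,[n_r]); bit k of a component says whether k + 1 is a member.
Subs : ∀ {r} → Vec ℕ r → Set
Subs []ᵥ       = ⊤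
Subs (n ∷ᵥ ns) = Vec Bool n × Subs ns

allSubs : ∀ {r} (n : Vec ℕ r) → List (Subs n)
allSubs []ᵥ       = tt ∷ []
allSubs (n ∷ᵥ ns) = concatMap (λ v → List.map (v ,_) (allSubs ns)) (allBits n)

complement : ∀ {r} (n : Vec ℕ r) → Subs n → Subs n
complement []ᵥ       tt      = tt
complement (n ∷ᵥ ns) (v , s) = Vec.map not v , complement ns s

sizes : ∀ {r} (n : Vec ℕ r) → Subs n → Vec ℕ r
sizes []ᵥ       tt      = []ᵥ
sizes (n ∷ᵥ ns) (v , s) = ones (toList v) ∷ᵥ sizes ns s

-- Finite sums and sums over i + j = n

module FiniteSums {c ℓ : Level} (Λ : CommutativeRing c ℓ) where
  open CommutativeRing Λ hiding (zero)
  open SetoidReasoning setoid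
  open CommutativeSemigroupProperties +-commutativeSemigroup using (interchange)

  -- Unfolds to `ΣL` of a mapped list, so the sums in `exp`, `_·_` and `weightedSum` are instances
  -- by definition.
  ∑ : {A : Set} → List A → (A → Carrier) → Carrier
  ∑ xs f = List.foldr _+_ 0# (List.map f xs)

  module _ {A : Set} where

    ∑-cong : ∀ (xs : List A) {f g : A → Carrier} → (∀ x → f x ≈ g x) → ∑ xs f ≈ ∑ xs g
    ∑-cong []       f≈g = refl
    ∑-cong (x ∷ xs) f≈g = +-cong (f≈g x) (∑-cong xs f≈g)

    ∑-zero : ∀ (xs : List A) {f : A → Carrier} → (∀ x → f x ≈ 0#) → ∑ xs f ≈ 0#
    ∑-zero []       f≈0 = refl
    ∑-zero (x ∷ xs) f≈0 = trans (+-cong (f≈0 x) (∑-zero xs f≈0)) (+-identityˡ 0#)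

    ∑-++ : ∀ (xs ys : List A) (f : A → Carrier) → ∑ (xs ++ ys) f ≈ ∑ xs f + ∑ ys f
    ∑-++ []       ys f = sym (+-identityˡ _)
    ∑-++ (x ∷ xs) ys f = trans (+-congˡ (∑-++ xs ys f)) (sym (+-assoc _ _ _))

    ∑-+ : ∀ (xs : List A) (f g : A → Carrier) → ∑ xs (λ x → f x + g x) ≈ ∑ xs f + ∑ xs g
    ∑-+ []       f g = sym (+-identityˡ 0#)
    ∑-+ (x ∷ xs) f g = trans (+-congˡ (∑-+ xs f g)) (interchange _ _ _ _)

    ∑-*ˡ : ∀ (xs : List A) a (f : A → Carrier) → ∑ xs (λ x → a * f x) ≈ a * ∑ xs f
    ∑-*ˡ []       a f = sym (zeroʳ a)
    ∑-*ˡ (x ∷ xs) a f = trans (+-congˡ (∑-*ˡ xs a f)) (sym (distribˡ _ _ _))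

    ∑-*ʳ : ∀ (xs : List A) (f : A → Carrier) a → ∑ xs (λ x → f x * a) ≈ ∑ xs f * a
    ∑-*ʳ []       f a = sym (zeroˡ a)
    ∑-*ʳ (x ∷ xs) f a = trans (+-congˡ (∑-*ʳ xs f a)) (sym (distribʳ _ _ _))

  module _ {A B : Set} where

    ∑-map : ∀ (h : A → B) xs (f : B → Carrier) → ∑ (List.map h xs) f ≈ ∑ xs (f ∘ h)
    ∑-map h []       f = refl
    ∑-map h (x ∷ xs) f = +-congˡ (∑-map h xs f)

    ∑-concatMap : ∀ (h : A → List B) xs (f : B → Carrier) →
                  ∑ (concatMap h xs) f ≈ ∑ xs (λ x → ∑ (h x) f)
    ∑-concatMap h []       f = refl
    ∑-concatMap h (x ∷ xs) f =
      trans (∑-++ (h x) (concatMap h xs) f) (+-congˡ (∑-concatMap h xs f))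

    ∑-swap : ∀ (xs : List A) (ys : List B) (f : A → B → Carrier) →
             ∑ xs (λ x → ∑ ys (f x)) ≈ ∑ ys (λ y → ∑ xs (λ x → f x y))
    ∑-swap []       ys f = sym (∑-zero ys (λ _ → refl))
    ∑-swap (x ∷ xs) ys f = trans (+-congˡ (∑-swap xs ys f)) (sym (∑-+ ys (f x) _))

  nat : ℕ → Carrier
  nat zero    = 0#
  nat (suc n) = 1# + nat n

  nat-+ : ∀ m n → nat (m +ℕ n) ≈ nat m + nat n
  nat-+ zero    n = sym (+-identityˡ _)
  nat-+ (suc m) n = trans (+-congˡ (nat-+ m n)) (sym (+-assoc _ _ _))

  ∑< : ℕ → (ℕ → Carrier) → Carrier
  ∑< zero    f = 0#
  ∑< (suc n) f = f 0 + ∑< n (f ∘ suc)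

  ∑<-applyUpTo : ∀ n (h : ℕ → ℕ) f → ∑ (applyUpTo h n) f ≈ ∑< n (f ∘ h)
  ∑<-applyUpTo zero    h f = refl
  ∑<-applyUpTo (suc n) h f = +-congˡ (∑<-applyUpTo n (h ∘ suc) f)

  ∑<-cong : ∀ n {f g} → (∀ k → f k ≈ g k) → ∑< n f ≈ ∑< n g
  ∑<-cong zero    f≈g = refl
  ∑<-cong (suc n) f≈g = +-cong (f≈g 0) (∑<-cong n (f≈g ∘ suc))

  ∑<-zero : ∀ n {f} → (∀ k → f k ≈ 0#) → ∑< n f ≈ 0#
  ∑<-zero zero    f≈0 = refl
  ∑<-zero (suc n) f≈0 = trans (+-cong (f≈0 0) (∑<-zero n (f≈0 ∘ suc))) (+-identityˡ 0#)

  ∑<-+ : ∀ n f g → ∑< n (λ k → f k + g k) ≈ ∑< n f + ∑< n g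
  ∑<-+ zero    f g = sym (+-identityˡ 0#)
  ∑<-+ (suc n) f g = trans (+-congˡ (∑<-+ n (f ∘ suc) (g ∘ suc))) (interchange _ _ _ _)

  ∑<-*ˡ : ∀ n a f → ∑< n (λ k → a * f k) ≈ a * ∑< n f
  ∑<-*ˡ zero    a f = sym (zeroʳ a)
  ∑<-*ˡ (suc n) a f = trans (+-congˡ (∑<-*ˡ n a (f ∘ suc))) (sym (distribˡ _ _ _))

  ∑<-truncate : ∀ {m n} f → m ≤ n → (∀ k → m ≤ k → f k ≈ 0#) → ∑< n f ≈ ∑< m f
  ∑<-truncate {n = n} f z≤n       f≈0 = ∑<-zero n (λ k → f≈0 k z≤n)
  ∑<-truncate         f (s≤s m≤n) f≈0 =
    +-congˡ (∑<-truncate (f ∘ suc) m≤n (λ k m≤k → f≈0 (suc k) (s≤s m≤k)))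

  -- The sum of φ i j over i + j = n. The recursion avoids the subtraction in the Cauchy product
  -- `_·_`; `conv-below` relates the two.
  conv₁ : ℕ → (ℕ → ℕ → Carrier) → Carrier
  conv₁ zero    φ = φ 0 0
  conv₁ (suc n) φ = φ 0 (suc n) + conv₁ n (λ i j → φ (suc i) j)

  conv : ∀ {r} → Vec ℕ r → (Vec ℕ r → Vec ℕ r → Carrier) → Carrier
  conv []ᵥ       φ = φ []ᵥ []ᵥ
  conv (n ∷ᵥ ns) φ = conv₁ n (λ i j → conv ns (λ is js → φ (i ∷ᵥ is) (j ∷ᵥ js)))

  conv₁-cong : ∀ n {φ ψ} → (∀ i j → i +ℕ j ≡ n → φ i j ≈ ψ i j) → conv₁ n φ ≈ conv₁ n ψ
  conv₁-cong zero    φ≈ψ = φ≈ψ 0 0 ≡.refl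
  conv₁-cong (suc n) φ≈ψ =
    +-cong (φ≈ψ 0 (suc n) ≡.refl) (conv₁-cong n (λ i j e → φ≈ψ (suc i) j (≡.cong suc e)))

  conv-cong : ∀ {r} (n : Vec ℕ r) {φ ψ} →
              (∀ i j → zipWith _+ℕ_ i j ≡ n → φ i j ≈ ψ i j) → conv n φ ≈ conv n ψ
  conv-cong []ᵥ       φ≈ψ = φ≈ψ []ᵥ []ᵥ ≡.refl
  conv-cong (n ∷ᵥ ns) φ≈ψ = conv₁-cong n λ i j e → conv-cong ns λ is js es →
    φ≈ψ (i ∷ᵥ is) (j ∷ᵥ js) (≡.cong₂ _∷ᵥ_ e es)

  conv₁-+ : ∀ n φ ψ → conv₁ n (λ i j → φ i j + ψ i j) ≈ conv₁ n φ + conv₁ n ψ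
  conv₁-+ zero    φ ψ = refl
  conv₁-+ (suc n) φ ψ = trans (+-congˡ (conv₁-+ n _ _)) (interchange _ _ _ _)

  conv-+ : ∀ {r} (n : Vec ℕ r) φ ψ → conv n (λ i j → φ i j + ψ i j) ≈ conv n φ + conv n ψ
  conv-+ []ᵥ       φ ψ = refl
  conv-+ (n ∷ᵥ ns) φ ψ = trans (conv₁-cong n (λ i j _ → conv-+ ns _ _)) (conv₁-+ n _ _)

  Additive : {A : Set} → ((A → Carrier) → Carrier) → Set (c ⊔ ℓ)
  Additive Φ = ∀ f g → Φ (λ x → f x + g x) ≈ Φ f + Φ g

  -- One interchange law for scaling by a constant (with `A = ⊤`), inner convolutions and truncated
  -- sums. Additivity suffices, without preservation of 0, because a convolution always has at least
  -- one term.
  conv₁-additive : ∀ {A : Set} {Φ : (A → Carrier) → Carrier} → Additive Φ →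
                   ∀ n (φ : ℕ → ℕ → A → Carrier) →
                   conv₁ n (λ i j → Φ (φ i j)) ≈ Φ (λ a → conv₁ n (λ i j → φ i j a))
  conv₁-additive Φ-add zero    φ = refl
  conv₁-additive Φ-add (suc n) φ =
    trans (+-congˡ (conv₁-additive Φ-add n _)) (sym (Φ-add _ _))

  conv-additive : ∀ {A : Set} {Φ : (A → Carrier) → Carrier} → Additive Φ →
                  ∀ {r} (n : Vec ℕ r) (φ : Vec ℕ r → Vec ℕ r → A → Carrier) →
                  conv n (λ i j → Φ (φ i j)) ≈ Φ (λ a → conv n (λ i j → φ i j a))
  conv-additive Φ-add []ᵥ       φ = refl
  conv-additive Φ-add (n ∷ᵥ ns) φ =
    trans (conv₁-cong n (λ i j _ → conv-additive Φ-add ns _)) (conv₁-additive Φ-add n _)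

  conv₁-*ˡ : ∀ n a φ → conv₁ n (λ i j → a * φ i j) ≈ a * conv₁ n φ
  conv₁-*ˡ n a φ = conv₁-additive {A = ⊤} {λ f → a * f tt} (λ f g → distribˡ _ _ _) n (λ i j _ → φ i j)

  conv-*ˡ : ∀ {r} (n : Vec ℕ r) a φ → conv n (λ i j → a * φ i j) ≈ a * conv n φ
  conv-*ˡ n a φ = conv-additive {A = ⊤} {λ f → a * f tt} (λ f g → distribˡ _ _ _) n (λ i j _ → φ i j)

  conv₁-last : ∀ n φ → conv₁ (suc n) φ ≈ conv₁ n (λ i j → φ i (suc j)) + φ (suc n) 0
  conv₁-last zero    φ = refl
  conv₁-last (suc n) φ =
    trans (+-congˡ (conv₁-last n (λ i j → φ (suc i) j))) (sym (+-assoc _ _ _))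

  conv₁-comm : ∀ n φ → conv₁ n φ ≈ conv₁ n (λ i j → φ j i)
  conv₁-comm zero    φ = refl
  conv₁-comm (suc n) φ = begin
    φ 0 (suc n) + conv₁ n (λ i j → φ (suc i) j)  ≈⟨ +-congˡ (conv₁-comm n _) ⟩
    φ 0 (suc n) + conv₁ n (λ i j → φ (suc j) i)  ≈⟨ +-comm _ _ ⟩
    conv₁ n (λ i j → φ (suc j) i) + φ 0 (suc n)  ≈⟨ conv₁-last n (λ i j → φ j i) ⟨
    conv₁ (suc n) (λ i j → φ j i)                ∎

  conv₁-assoc : ∀ n (φ : ℕ → ℕ → ℕ → Carrier) →
    conv₁ n (λ i j → conv₁ j (λ k l → φ i k l)) ≈ conv₁ n (λ m l → conv₁ m (λ i k → φ i k l))
  conv₁-assoc zero    φ = refl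
  conv₁-assoc (suc n) φ = begin
    (φ 0 0 (suc n) + conv₁ n (λ k l → φ 0 (suc k) l))
      + conv₁ n (λ i j → conv₁ j (λ k l → φ (suc i) k l))
      ≈⟨ +-congˡ (conv₁-assoc n (φ ∘ suc)) ⟩
    (φ 0 0 (suc n) + conv₁ n (λ k l → φ 0 (suc k) l))
      + conv₁ n (λ m l → conv₁ m (λ i k → φ (suc i) k l))
      ≈⟨ +-assoc _ _ _ ⟩
    φ 0 0 (suc n) + (conv₁ n (λ k l → φ 0 (suc k) l)
      + conv₁ n (λ m l → conv₁ m (λ i k → φ (suc i) k l)))
      ≈⟨ +-congˡ (conv₁-+ n _ _) ⟨
    φ 0 0 (suc n) + conv₁ n (λ m l → conv₁ (suc m) (λ i k → φ i k l)) ∎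

  conv₁-exchange : ∀ n (φ : ℕ → ℕ → ℕ → Carrier) →
    conv₁ n (λ i j → conv₁ j (λ k l → φ i k l)) ≈ conv₁ n (λ i j → conv₁ j (λ k l → φ k i l))
  conv₁-exchange n φ = begin
    conv₁ n (λ i j → conv₁ j (λ k l → φ i k l))  ≈⟨ conv₁-assoc n φ ⟩
    conv₁ n (λ m l → conv₁ m (λ i k → φ i k l))  ≈⟨ conv₁-cong n (λ m l _ → conv₁-comm m _) ⟩
    conv₁ n (λ m l → conv₁ m (λ i k → φ k i l))  ≈⟨ conv₁-assoc n (λ i k l → φ k i l) ⟨
    conv₁ n (λ i j → conv₁ j (λ k l → φ k i l))  ∎

  -- The coordinates are exchanged one at a time. Before that, the inner sum over the first
  -- coordinate must be moved past the outer sum over the remaining ones, which `conv-additive` does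
  -- with `A = ℕ × ℕ`.
  conv-exchange : ∀ {r} (n : Vec ℕ r) (φ : Vec ℕ r → Vec ℕ r → Vec ℕ r → Carrier) →
    conv n (λ i j → conv j (λ k l → φ i k l)) ≈ conv n (λ i j → conv j (λ k l → φ k i l))
  conv-exchange []ᵥ       φ = refl
  conv-exchange (n ∷ᵥ ns) φ = begin
    conv₁ n (λ i j → conv ns λ is js → conv₁ j λ k l → conv js λ ks ls →
      φ (i ∷ᵥ is) (k ∷ᵥ ks) (l ∷ᵥ ls))
      ≈⟨ conv₁-cong n (λ i j _ → conv-additive {A = ℕ × ℕ} {λ f → conv₁ j (λ k l → f (k , l))} (λ f g → conv₁-+ j _ _) ns _) ⟩
    conv₁ n (λ i j → conv₁ j λ k l → conv ns λ is js → conv js λ ks ls →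
      φ (i ∷ᵥ is) (k ∷ᵥ ks) (l ∷ᵥ ls))
      ≈⟨ conv₁-exchange n _ ⟩
    conv₁ n (λ i j → conv₁ j λ k l → conv ns λ is js → conv js λ ks ls →
      φ (k ∷ᵥ is) (i ∷ᵥ ks) (l ∷ᵥ ls))
      ≈⟨ conv₁-cong n (λ i j _ → conv₁-cong j (λ k l _ → conv-exchange ns _)) ⟩
    conv₁ n (λ i j → conv₁ j λ k l → conv ns λ is js → conv js λ ks ls →
      φ (k ∷ᵥ ks) (i ∷ᵥ is) (l ∷ᵥ ls))
      ≈⟨ conv₁-cong n (λ i j _ → conv-additive {A = ℕ × ℕ} {λ f → conv₁ j (λ k l → f (k , l))} (λ f g → conv₁-+ j _ _) ns _) ⟨
    conv₁ n (λ i j → conv ns λ is js → conv₁ j λ k l → conv js λ ks ls →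
      φ (k ∷ᵥ ks) (i ∷ᵥ is) (l ∷ᵥ ls)) ∎

  conv₁-∑< : ∀ n (φ : ℕ → ℕ → Carrier) → ∑< (suc n) (λ i → φ i (n ∸ i)) ≈ conv₁ n φ
  conv₁-∑< zero    φ = +-identityʳ _
  conv₁-∑< (suc n) φ = +-congˡ (conv₁-∑< n (λ i j → φ (suc i) j))

-- Exponential series and the Euler operator

module Exponential {c ℓ : Level} (Λ : CommutativeRing c ℓ) (ι : ℚ → CommutativeRing.Carrier Λ)
                   (ι-mono : RingMorphisms.IsRingMonomorphism +-*-rawRing (CommutativeRing.rawRing Λ) ι) where
  open CommutativeRing Λ hiding (zero)
  open SetoidReasoning setoid
  open FiniteSums Λ
  open PowerSeries Λ ι
  open RingMorphisms.IsRingMonomorphism ι-mono using (⟦⟧-cong; +-homo; *-homo; 0#-homo; 1#-homo)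
  open CommutativeSemigroupProperties *-commutativeSemigroup using (x∙yz≈y∙xz)
  open SemiringSolver commutativeSemiring using (solve; _:*_; _:=_)

  ι-nat : ∀ n → ι (+ n / 1) ≈ nat n
  ι-nat zero    = 0#-homo
  ι-nat (suc n) = begin
    ι (+ suc n / 1)              ≈⟨ ⟦⟧-cong (suc/1 n) ⟩
    ι (ℚ.1ℚ ℚ.+ (+ n / 1))         ≈⟨ +-homo _ _ ⟩
    ι ℚ.1ℚ + ι (+ n / 1)         ≈⟨ +-cong 1#-homo (ι-nat n) ⟩
    1# + nat n                   ∎

  nat*invFact : ∀ n → nat (suc n) * invFact (suc n) ≈ invFact n
  nat*invFact n = begin
    nat (suc n) * invFact (suc n)            ≈⟨ *-congʳ (ι-nat (suc n)) ⟨
    ι (+ suc n / 1) * invFact (suc n)        ≈⟨ *-homo _ _ ⟨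
    ι ((+ suc n / 1) ℚ.* _)                    ≈⟨ ⟦⟧-cong (m/1*1/md (suc n) (n !) (suc n !) {{n ℕₚ.!≢0}} {{suc n ℕₚ.!≢0}} ≡.refl) ⟩
    invFact n                                ∎

  invFact0 : invFact 0 ≈ 1#
  invFact0 = 1#-homo

  -- Here ℚ ⊆ Λ enters: ι(1/(n+1)) inverts n + 1. Both inductions that know a quantity only up to a
  -- positive integer factor, `exp-unique` and `∑-allBits`, rest on it.
  nat-cancel : ∀ n {a b} → nat (suc n) * a ≈ nat (suc n) * b → a ≈ b
  nat-cancel n {a} {b} e = begin
    a                       ≈⟨ inverse a ⟨
    u * (nat (suc n) * a)   ≈⟨ *-congˡ e ⟩
    u * (nat (suc n) * b)   ≈⟨ inverse b ⟩
    b                       ∎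
    where
    u = ι (+ 1 / suc n)
    inverse : ∀ x → u * (nat (suc n) * x) ≈ x
    inverse x = begin
      u * (nat (suc n) * x)           ≈⟨ solve 3 (λ a b c → a :* (b :* c) := (b :* a) :* c) refl _ _ _ ⟩
      (nat (suc n) * u) * x           ≈⟨ *-congʳ (*-congʳ (ι-nat (suc n))) ⟨
      (ι (+ suc n / 1) * u) * x       ≈⟨ *-congʳ (*-homo _ _) ⟨
      ι ((+ suc n / 1) ℚ.* (+ 1 / suc n)) * x
        ≈⟨ *-congʳ (⟦⟧-cong (m/1*1/md (suc n) 1 (suc n) (≡.sym (ℕₚ.*-identityʳ (suc n))))) ⟩
      ι ℚ.1ℚ * x                      ≈⟨ *-congʳ 1#-homo ⟩
      1# * x                          ≈⟨ *-identityˡ x ⟩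
      x                               ∎

  conv-below : ∀ {r} (n : Vec ℕ r) φ → ∑ (below n) (λ m → φ m (zipWith _∸_ n m)) ≈ conv n φ
  conv-below []ᵥ       φ = +-identityʳ _
  conv-below (n ∷ᵥ ns) φ = begin
    ∑ (below (n ∷ᵥ ns)) (λ m → φ m (zipWith _∸_ (n ∷ᵥ ns) m))
      ≈⟨ ∑-concatMap (λ i → List.map (i ∷ᵥ_) (below ns)) (upTo (suc n)) _ ⟩
    ∑ (upTo (suc n)) (λ i → ∑ (List.map (i ∷ᵥ_) (below ns)) (λ m → φ m (zipWith _∸_ (n ∷ᵥ ns) m)))
      ≈⟨ ∑-cong (upTo (suc n)) (λ i → trans (∑-map (i ∷ᵥ_) (below ns) _) (conv-below ns _)) ⟩
    ∑ (upTo (suc n)) (λ i → conv ns (λ is js → φ (i ∷ᵥ is) (n ∸ i ∷ᵥ js)))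
      ≈⟨ ∑<-applyUpTo (suc n) id _ ⟩
    ∑< (suc n) (λ i → conv ns (λ is js → φ (i ∷ᵥ is) (n ∸ i ∷ᵥ js)))
      ≈⟨ conv₁-∑< n _ ⟩
    conv (n ∷ᵥ ns) φ ∎

  ·-conv : ∀ {r} (f g : PS r) n → (f · g) n ≈ conv n (λ i j → f i * g j)
  ·-conv f g n = conv-below n (λ i j → f i * g j)

  total-+ : ∀ {r} (i j : Vec ℕ r) → total (zipWith _+ℕ_ i j) ≡ total i +ℕ total j
  total-+ []ᵥ      []ᵥ      = ≡.refl
  total-+ (i ∷ᵥ is) (j ∷ᵥ js) = ≡.trans (≡.cong (i +ℕ j +ℕ_) (total-+ is js))
    (ℕ-interchange i j (total is) (total js))

  total-split : ∀ {r} {n : Vec ℕ r} i j → zipWith _+ℕ_ i j ≡ n → total n ≡ total i +ℕ total j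
  total-split i j ≡.refl = total-+ i j

  one-zero : ∀ {r} (n : Vec ℕ r) → total n ≡ 0 → one n ≈ 1#
  one-zero []ᵥ          _ = refl
  one-zero (zero ∷ᵥ ns) e = one-zero ns e

  one-nonzero : ∀ {r} (n : Vec ℕ r) → 0 < total n → one n ≈ 0#
  one-nonzero (zero  ∷ᵥ ns) p = one-nonzero ns p
  one-nonzero (suc _ ∷ᵥ ns) _ = refl

  nat-total*one : ∀ {r} (n : Vec ℕ r) → nat (total n) * one n ≈ 0#
  nat-total*one n with total n in e
  ... | zero  = zeroˡ _
  ... | suc k = trans (*-congˡ (one-nonzero n (≡.subst (0 <_) (≡.sym e) (s≤s z≤n)))) (zeroʳ _)

  -- The Euler operator ∑ᵢ zᵢ∂/∂zᵢ.
  euler : ∀ {r} → PS r → PS r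
  euler f n = nat (total n) * f n

  module _ {r : ℕ} (g : PS r) where

    -- The total degree is additive along i + j = n, which is the Leibniz rule. By the power rule
    -- for g^k and an exchange of the factors g and Dg, the second Leibniz term is k copies of the
    -- first.
    euler-^ : ∀ k n → euler (g ^ suc k) n ≈ nat (suc k) * conv n (λ i j → euler g i * (g ^ k) j)
    euler-^ k n = begin
      nat (total n) * (g · (g ^ k)) n
        ≈⟨ *-congˡ (·-conv g (g ^ k) n) ⟩
      nat (total n) * conv n (λ i j → g i * (g ^ k) j)
        ≈⟨ conv-*ˡ n _ _ ⟨
      conv n (λ i j → nat (total n) * (g i * (g ^ k) j))
        ≈⟨ conv-cong n leibniz ⟩
      conv n (λ i j → euler g i * (g ^ k) j + g i * euler (g ^ k) j)
        ≈⟨ conv-+ n _ _ ⟩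
      X + conv n (λ i j → g i * euler (g ^ k) j)
        ≈⟨ +-cong (sym (*-identityˡ X)) (rest k) ⟩
      1# * X + nat k * X
        ≈⟨ distribʳ _ _ _ ⟨
      nat (suc k) * X ∎
      where
      X = conv n (λ i j → euler g i * (g ^ k) j)

      leibniz : ∀ i j → zipWith _+ℕ_ i j ≡ n →
                nat (total n) * (g i * (g ^ k) j) ≈ euler g i * (g ^ k) j + g i * euler (g ^ k) j
      leibniz i j e = begin
        nat (total n) * (g i * (g ^ k) j)
          ≈⟨ *-congʳ (trans (reflexive (≡.cong nat (total-split i j e))) (nat-+ (total i) (total j))) ⟩
        (nat (total i) + nat (total j)) * (g i * (g ^ k) j)
          ≈⟨ distribʳ _ _ _ ⟩
        nat (total i) * (g i * (g ^ k) j) + nat (total j) * (g i * (g ^ k) j)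
          ≈⟨ +-cong (sym (*-assoc _ _ _)) (x∙yz≈y∙xz _ _ _) ⟩
        euler g i * (g ^ k) j + g i * euler (g ^ k) j ∎

      rest : ∀ k → conv n (λ i j → g i * euler (g ^ k) j) ≈
                   nat k * conv n (λ i j → euler g i * (g ^ k) j)
      rest zero = begin
        conv n (λ i j → g i * euler one j)
          -- Zero terms are written as multiples of `0#`, which `conv-*ˡ` pulls out of the
          -- convolution.
          ≈⟨ conv-cong n (λ i j _ → trans (*-congˡ (nat-total*one j)) (trans (zeroʳ _) (sym (zeroˡ _)))) ⟩
        conv n (λ i j → 0# * g i)
          ≈⟨ conv-*ˡ n _ _ ⟩
        0# * conv n (λ i j → g i)
          ≈⟨ trans (zeroˡ _) (sym (zeroˡ _)) ⟩
        0# * conv n (λ i j → euler g i * one j) ∎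
      rest (suc k) = begin
        conv n (λ i j → g i * euler (g ^ suc k) j)
          ≈⟨ conv-cong n (λ i j _ → trans (*-congˡ (euler-^ k j))
               (x∙yz≈y∙xz _ _ _)) ⟩
        conv n (λ i j → nat (suc k) * (g i * conv j (λ i′ l → euler g i′ * (g ^ k) l)))
          ≈⟨ conv-*ˡ n _ _ ⟩
        nat (suc k) * conv n (λ i j → g i * conv j (λ i′ l → euler g i′ * (g ^ k) l))
          ≈⟨ *-congˡ (conv-cong n (λ i j _ → conv-*ˡ j _ _)) ⟨
        nat (suc k) * conv n (λ i j → conv j (λ i′ l → g i * (euler g i′ * (g ^ k) l)))
          ≈⟨ *-congˡ (conv-exchange n (λ i i′ l → g i * (euler g i′ * (g ^ k) l))) ⟩
        nat (suc k) * conv n (λ i j → conv j (λ i′ l → g i′ * (euler g i * (g ^ k) l)))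
          ≈⟨ *-congˡ (conv-cong n (λ i j _ → trans
               (conv-cong j (λ _ _ _ → x∙yz≈y∙xz _ _ _))
               (trans (conv-*ˡ j _ _) (*-congˡ (sym (·-conv g (g ^ k) j)))))) ⟩
        nat (suc k) * conv n (λ i j → euler g i * (g ^ suc k) j) ∎

    module _ (g0 : ∀ n → total n ≡ 0 → g n ≈ 0#) where

      -- As g has no constant term, g^k has order at least k: in i + j = n either i = 0 and g i
      -- vanishes, or j has smaller total degree than n. This justifies the cut-off in `exp`.
      ^-vanishes : ∀ k n → total n < k → (g ^ k) n ≈ 0#
      ^-vanishes (suc k) n (s≤s n≤k) = begin
        (g · (g ^ k)) n                  ≈⟨ ·-conv g (g ^ k) n ⟩
        conv n (λ i j → g i * (g ^ k) j) ≈⟨ conv-cong n (λ i j e → trans (term i j e) (sym (zeroˡ _))) ⟩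
        conv n (λ i j → 0# * 0#)         ≈⟨ conv-*ˡ n _ _ ⟩
        0# * conv n (λ i j → 0#)         ≈⟨ zeroˡ _ ⟩
        0#                               ∎
        where
        term : ∀ i j → zipWith _+ℕ_ i j ≡ n → g i * (g ^ k) j ≈ 0#
        term i j e with total i in ti | total-split i j e
        ... | zero  | _  = trans (*-congʳ (g0 i ti)) (zeroˡ _)
        ... | suc a | te = trans (*-congˡ (^-vanishes k j
              (ℕₚ.≤-trans (s≤s (ℕₚ.m≤n+m (total j) a)) (ℕₚ.≤-trans (ℕₚ.≤-reflexive (≡.sym te)) n≤k))))
              (zeroʳ _)

      exp-∑< : ∀ n → exp g n ≈ ∑< (suc (total n)) (λ k → invFact k * (g ^ k) n)
      exp-∑< n = ∑<-applyUpTo (suc (total n)) id _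

      -- The power rule applies term by term, its factor k + 1 turning 1/(k+1)! into 1/k!. The
      -- cut-offs then disagree: the sum runs up to a bound from n, while `exp g j` stops at the
      -- total degree of j.
      euler-exp : ∀ n → euler (exp g) n ≈ conv n (λ i j → euler g i * exp g j)
      euler-exp n = begin
        nat (total n) * exp g n
          ≈⟨ *-congˡ (exp-∑< n) ⟩
        nat (total n) * ∑< (suc (total n)) (λ k → invFact k * (g ^ k) n)
          ≈⟨ ∑<-*ˡ (suc (total n)) _ (λ k → invFact k * (g ^ k) n) ⟨
        nat (total n) * (invFact 0 * one n) + ∑< (total n) (λ k → nat (total n) * (invFact (suc k) * (g ^ suc k) n))
          ≈⟨ +-cong first (∑<-cong (total n) later) ⟩
        0# + ∑< (total n) (λ k → invFact k * conv n (λ i j → euler g i * (g ^ k) j))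
          ≈⟨ +-identityˡ _ ⟩
        ∑< (total n) (λ k → invFact k * conv n (λ i j → euler g i * (g ^ k) j))
          ≈⟨ ∑<-cong (total n) (λ k → trans (sym (conv-*ˡ n _ _)) (conv-cong n (λ i j _ →
               x∙yz≈y∙xz _ _ _))) ⟩
        ∑< (total n) (λ k → conv n (λ i j → euler g i * (invFact k * (g ^ k) j)))
          ≈⟨ conv-additive (∑<-+ (total n)) n _ ⟨
        conv n (λ i j → ∑< (total n) (λ k → euler g i * (invFact k * (g ^ k) j)))
          ≈⟨ conv-cong n (λ i j e → trans (∑<-*ˡ (total n) _ _) (truncate i j e)) ⟩
        conv n (λ i j → euler g i * exp g j) ∎
        where
        first : nat (total n) * (invFact 0 * one n) ≈ 0#
        first = trans (x∙yz≈y∙xz _ _ _)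
          (trans (*-congˡ (nat-total*one n)) (zeroʳ _))

        later : ∀ k → nat (total n) * (invFact (suc k) * (g ^ suc k) n) ≈
                      invFact k * conv n (λ i j → euler g i * (g ^ k) j)
        later k = begin
          nat (total n) * (invFact (suc k) * (g ^ suc k) n)
            ≈⟨ x∙yz≈y∙xz _ _ _ ⟩
          invFact (suc k) * euler (g ^ suc k) n
            ≈⟨ *-congˡ (euler-^ k n) ⟩
          invFact (suc k) * (nat (suc k) * conv n (λ i j → euler g i * (g ^ k) j))
            ≈⟨ solve 3 (λ a b c → a :* (b :* c) := (b :* a) :* c) refl _ _ _ ⟩
          (nat (suc k) * invFact (suc k)) * conv n (λ i j → euler g i * (g ^ k) j)
            ≈⟨ *-congʳ (nat*invFact k) ⟩
          invFact k * conv n (λ i j → euler g i * (g ^ k) j) ∎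

        truncate : ∀ i j → zipWith _+ℕ_ i j ≡ n →
          euler g i * ∑< (total n) (λ k → invFact k * (g ^ k) j) ≈ euler g i * exp g j
        -- If i has degree 0, the Euler factor kills both sides. Otherwise j has smaller degree than
        -- n, and the surplus powers of g vanish at j.
        truncate i j e with total i in ti | total-split i j e
        ... | zero  | _  = trans (*-congʳ (zeroˡ _)) (trans (zeroˡ _) (sym (trans (*-congʳ (zeroˡ _)) (zeroˡ _))))
        ... | suc a | te = *-congˡ (trans
              (∑<-truncate _ (ℕₚ.≤-trans (s≤s (ℕₚ.m≤n+m (total j) a)) (ℕₚ.≤-reflexive (≡.sym te)))
                 (λ k j<k → trans (*-congˡ (^-vanishes k j j<k)) (zeroʳ _)))
              (sym (exp-∑< j)))

      exp-constant : ∀ n → total n ≡ 0 → exp g n ≈ 1#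
      exp-constant n tn = begin
        exp g n                               ≈⟨ exp-∑< n ⟩
        ∑< (suc (total n)) (λ k → invFact k * (g ^ k) n)
          ≈⟨ reflexive (≡.cong (λ t → ∑< (suc t) (λ k → invFact k * (g ^ k) n)) tn) ⟩
        invFact 0 * one n + 0#                ≈⟨ +-identityʳ _ ⟩
        invFact 0 * one n                     ≈⟨ *-cong invFact0 (one-zero n tn) ⟩
        1# * 1#                               ≈⟨ *-identityˡ 1# ⟩
        1#                                    ∎

      -- The summands with i of degree 0, the only ones that involve f at full degree, vanish
      -- through the Euler factor. So the equation determines total(n) f(n) from f in lower degree.
      -- The recursion is on a bound b for the degree.
      exp-unique : ∀ (f : PS r) → (∀ n → total n ≡ 0 → f n ≈ 1#) →
                   (∀ n → euler f n ≈ conv n (λ i j → euler g i * f j)) → ∀ n → f n ≈ exp g n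
      exp-unique f f0 euler-f n = go (suc (total n)) n (total n) ≡.refl ℕₚ.≤-refl
        where
        go : ∀ b n t → total n ≡ t → t < b → f n ≈ exp g n
        go b       n zero    tn _         = trans (f0 n tn) (sym (exp-constant n tn))
        go (suc b) n (suc t) tn (s≤s n≤b) = nat-cancel t (begin
          nat (suc t) * f n                     ≈⟨ *-congʳ (reflexive (≡.cong nat tn)) ⟨
          euler f n                             ≈⟨ euler-f n ⟩
          conv n (λ i j → euler g i * f j)      ≈⟨ conv-cong n step ⟩
          conv n (λ i j → euler g i * exp g j)  ≈⟨ euler-exp n ⟨
          euler (exp g) n                       ≈⟨ *-congʳ (reflexive (≡.cong nat tn)) ⟩
          nat (suc t) * exp g n                 ∎)
          where
          step : ∀ i j → zipWith _+ℕ_ i j ≡ n → euler g i * f j ≈ euler g i * exp g j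
          step i j e with total i in ti | total-split i j e
          ... | zero  | _  = trans (*-congʳ (zeroˡ _)) (trans (zeroˡ _) (sym (trans (*-congʳ (zeroˡ _)) (zeroˡ _))))
          ... | suc a | te = *-congˡ (go b j (total j) ≡.refl (ℕₚ.≤-trans (s≤s (ℕₚ.m≤n+m (total j) a))
                (ℕₚ.≤-trans (ℕₚ.≤-reflexive (≡.trans (≡.sym te) tn)) n≤b)))

  -- n!/(i! j!) of the subsets A of [n] have |A| = i and |Aᶜ| = j.
  ∑-allBits : ∀ n φ →
    invFact n * ∑ (allBits n) (λ v → φ (ones (toList v)) (ones (toList (Vec.map not v)))) ≈
    conv₁ n (λ i j → (invFact i * invFact j) * φ i j)
  ∑-allBits zero    φ = *-cong (sym (trans (*-congˡ invFact0) (*-identityʳ _))) (+-identityʳ _)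
  -- After multiplication by n + 1 = i + j this is Pascal's rule: i/(i! j!) accounts for the subsets
  -- that contain the first point, j/(i! j!) for those that avoid it.
  ∑-allBits (suc n) φ = nat-cancel n (begin
    nat (suc n) * (invFact (suc n) * ∑ (allBits (suc n)) (uncurry φ ∘ sizes₂))
      ≈⟨ *-assoc _ _ _ ⟨
    (nat (suc n) * invFact (suc n)) * ∑ (allBits (suc n)) (uncurry φ ∘ sizes₂)
      ≈⟨ *-cong (nat*invFact n) (trans (∑-++ (List.map (true ∷ᵥ_) (allBits n)) _ _)
           (+-cong (∑-map (true ∷ᵥ_) (allBits n) _) (∑-map (false ∷ᵥ_) (allBits n) _))) ⟩
    invFact n * (∑ (allBits n) (uncurry φ₁ ∘ sizes₂) + ∑ (allBits n) (uncurry φ₂ ∘ sizes₂))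
      ≈⟨ distribˡ _ _ _ ⟩
    invFact n * ∑ (allBits n) (uncurry φ₁ ∘ sizes₂) + invFact n * ∑ (allBits n) (uncurry φ₂ ∘ sizes₂)
      ≈⟨ +-cong (∑-allBits n φ₁) (∑-allBits n φ₂) ⟩
    conv₁ n (λ i j → (invFact i * invFact j) * φ (suc i) j) + conv₁ n (λ i j → (invFact i * invFact j) * φ i (suc j))
      ≈⟨ +-cong left right ⟨
    conv₁ (suc n) (λ i j → nat i * ψ i j) + conv₁ (suc n) (λ i j → nat j * ψ i j)
      ≈⟨ conv₁-+ (suc n) (λ i j → nat i * ψ i j) (λ i j → nat j * ψ i j) ⟨
    conv₁ (suc n) (λ i j → nat i * ψ i j + nat j * ψ i j)
      ≈⟨ conv₁-cong (suc n) (λ i j e → trans (sym (distribʳ (ψ i j) (nat i) (nat j)))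
           (*-congʳ (trans (sym (nat-+ i j)) (reflexive (≡.cong nat e))))) ⟩
    conv₁ (suc n) (λ i j → nat (suc n) * ψ i j)
      ≈⟨ conv₁-*ˡ (suc n) (nat (suc n)) ψ ⟩
    nat (suc n) * conv₁ (suc n) ψ ∎)
    where
    sizes₂ : ∀ {m} → Vec Bool m → ℕ × ℕ
    sizes₂ v = ones (toList v) , ones (toList (Vec.map not v))

    φ₁ φ₂ ψ : ℕ → ℕ → Carrier
    φ₁ i j = φ (suc i) j
    φ₂ i j = φ i (suc j)
    ψ i j = (invFact i * invFact j) * φ i j

    left : conv₁ (suc n) (λ i j → nat i * ψ i j) ≈ conv₁ n (λ i j → (invFact i * invFact j) * φ (suc i) j)
    left = trans (+-cong (zeroˡ _) (conv₁-cong n (λ i j _ → trans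
      (solve 4 (λ a b c d → a :* ((b :* c) :* d) := ((a :* b) :* c) :* d) refl _ _ _ _)
      (*-congʳ (*-congʳ (nat*invFact i)))))) (+-identityˡ _)

    right : conv₁ (suc n) (λ i j → nat j * ψ i j) ≈ conv₁ n (λ i j → (invFact i * invFact j) * φ i (suc j))
    right = trans (conv₁-last n (λ i j → nat j * ψ i j)) (trans (+-cong (conv₁-cong n (λ i j _ → trans
      (solve 4 (λ a b c d → a :* ((b :* c) :* d) := (b :* (a :* c)) :* d) refl _ _ _ _)
      (*-congʳ (*-congˡ (nat*invFact j))))) (zeroˡ _)) (+-identityʳ _))

  -- Sorts are treated one at a time: the convolution over the remaining sorts serves as the φ of
  -- `∑-allBits`.
  ∑-allSubs : ∀ {r} (n : Vec ℕ r) (φ : Vec ℕ r → Vec ℕ r → Carrier) →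
    invMultiFact n * ∑ (allSubs n) (λ s → φ (sizes n s) (sizes n (complement n s))) ≈
    conv n (λ i j → (invMultiFact i * invMultiFact j) * φ i j)
  ∑-allSubs []ᵥ       φ = *-cong (sym (*-identityʳ _)) (+-identityʳ _)
  ∑-allSubs (n ∷ᵥ ns) φ = begin
    (invFact n * invMultiFact ns) * ∑ (allSubs (n ∷ᵥ ns)) (λ s → φ (sizes (n ∷ᵥ ns) s) (sizes (n ∷ᵥ ns) (complement (n ∷ᵥ ns) s)))
      ≈⟨ *-congˡ (trans (∑-concatMap (λ v → List.map (v ,_) (allSubs ns)) (allBits n) _)
           (∑-cong (allBits n) (λ v → ∑-map (v ,_) (allSubs ns) _))) ⟩
    (invFact n * invMultiFact ns) * ∑ (allBits n) (λ v → ∑ (allSubs ns) (λ s → Φ v s))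
      ≈⟨ *-assoc _ _ _ ⟩
    invFact n * (invMultiFact ns * ∑ (allBits n) (λ v → ∑ (allSubs ns) (λ s → Φ v s)))
      ≈⟨ *-congˡ (∑-*ˡ (allBits n) _ _) ⟨
    invFact n * ∑ (allBits n) (λ v → invMultiFact ns * ∑ (allSubs ns) (λ s → Φ v s))
      ≈⟨ *-congˡ (∑-cong (allBits n) (λ v → ∑-allSubs ns _)) ⟩
    invFact n * ∑ (allBits n) (λ v → Ψ (ones (toList v)) (ones (toList (Vec.map not v))))
      ≈⟨ ∑-allBits n Ψ ⟩
    conv₁ n (λ i j → (invFact i * invFact j) * Ψ i j)
      ≈⟨ conv₁-cong n (λ i j _ → trans (sym (conv-*ˡ ns _ _)) (conv-cong ns (λ is js _ →
           solve 5 (λ a b c d e → (a :* b) :* ((c :* d) :* e) := ((a :* c) :* (b :* d)) :* e) refl _ _ _ _ _))) ⟩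
    conv (n ∷ᵥ ns) (λ i j → (invMultiFact i * invMultiFact j) * φ i j) ∎
    where
    Φ : Vec Bool n → Subs ns → Carrier
    Φ v s = φ (ones (toList v) ∷ᵥ sizes ns s) (ones (toList (Vec.map not v)) ∷ᵥ sizes ns (complement ns s))

    Ψ : ℕ → ℕ → Carrier
    Ψ i j = conv ns (λ is js → (invMultiFact is * invMultiFact js) * φ (i ∷ᵥ is) (j ∷ᵥ js))

-- Finite sets of labels

module LabelSets where
  open ≡ using (refl; sym; trans; cong; cong₂; subst)

  -- Membership and extensionality of canonical finite sets

  bitAt-fromBits : ∀ bs n → n ∈? fromBits bs ≡ bitAt bs n
  bitAt-fromBits []       n = refl
  bitAt-fromBits (b ∷ bs) n with fromBits bs | bitAt-fromBits bs
  bitAt-fromBits (true  ∷ bs) zero    | nothing | ih = refl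
  bitAt-fromBits (true  ∷ bs) (suc n) | nothing | ih = ih n
  bitAt-fromBits (false ∷ bs) zero    | nothing | ih = refl
  bitAt-fromBits (false ∷ bs) (suc n) | nothing | ih = ih n
  bitAt-fromBits (b     ∷ bs) zero    | just cs | ih = refl
  bitAt-fromBits (b     ∷ bs) (suc n) | just cs | ih = ih n

  ones-fromBits : ∀ bs → ones (toBits (fromBits bs)) ≡ ones bs
  ones-fromBits []       = refl
  ones-fromBits (b ∷ bs) with fromBits bs | ones-fromBits bs
  ones-fromBits (true  ∷ bs) | nothing | ih = cong suc ih
  ones-fromBits (false ∷ bs) | nothing | ih = ih
  ones-fromBits (true  ∷ bs) | just cs | ih = cong suc ih
  ones-fromBits (false ∷ bs) | just cs | ih = ih

  bitAt-zipPad : ∀ op → op false false ≡ false → ∀ as bs n →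
                 bitAt (zipPad op as bs) n ≡ op (bitAt as n) (bitAt bs n)
  bitAt-zipPad op e []       []       n       = sym e
  bitAt-zipPad op e []       (b ∷ bs) zero    = refl
  bitAt-zipPad op e []       (b ∷ bs) (suc n) = bitAt-zipPad op e [] bs n
  bitAt-zipPad op e (a ∷ as) []       zero    = refl
  bitAt-zipPad op e (a ∷ as) []       (suc n) = bitAt-zipPad op e as [] n
  bitAt-zipPad op e (a ∷ as) (b ∷ bs) zero    = refl
  bitAt-zipPad op e (a ∷ as) (b ∷ bs) (suc n) = bitAt-zipPad op e as bs n

  ∈-∪ₛ : ∀ A B n → n ∈? (A ∪ₛ B) ≡ (n ∈? A) ∨ (n ∈? B)
  ∈-∪ₛ A B n = trans (bitAt-fromBits (zipPad _∨_ (toBits A) (toBits B)) n) (bitAt-zipPad _∨_ refl (toBits A) (toBits B) n)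

  ∈-∩ₛ : ∀ A B n → n ∈? (A ∩ₛ B) ≡ (n ∈? A) ∧ (n ∈? B)
  ∈-∩ₛ A B n = trans (bitAt-fromBits (zipPad _∧_ (toBits A) (toBits B)) n) (bitAt-zipPad _∧_ refl (toBits A) (toBits B) n)

  bitAt-last : ∀ bs → bitAt (bs ++ [ true ]) (length bs) ≡ true
  bitAt-last []       = refl
  bitAt-last (b ∷ bs) = bitAt-last bs

  false≢true : false ≢ true
  false≢true ()

  -- Every nonempty representation ends in a `true` bit, and its position tells apart
  -- representations of different lengths.
  ∈-ext : ∀ A B → (∀ n → n ∈? A ≡ n ∈? B) → A ≡ B
  ∈-ext nothing   nothing   e = refl
  ∈-ext nothing   (just bs) e = ⊥-elim (false≢true (trans (e (length bs)) (bitAt-last bs)))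
  ∈-ext (just as) nothing   e = ⊥-elim (false≢true (trans (sym (e (length as))) (bitAt-last as)))
  ∈-ext (just as) (just bs) e = cong just (go as bs e)
    where
    go : ∀ as bs → (∀ n → bitAt (as ++ [ true ]) n ≡ bitAt (bs ++ [ true ]) n) → as ≡ bs
    go []       []       e = refl
    go []       (b ∷ bs) e = ⊥-elim (false≢true (trans (e (suc (length bs))) (bitAt-last bs)))
    go (a ∷ as) []       e = ⊥-elim (false≢true (trans (sym (e (suc (length as)))) (bitAt-last as)))
    go (a ∷ as) (b ∷ bs) e = cong₂ _∷_ (e 0) (go as bs (e ∘ suc))

  mem : ∀ {r} → Obj r → Fin r → ℕ → Bool
  mem Ω i n = n ∈? lookup Ω i

  _≟ₒ_ : ∀ {r} → DecidableEquality (Obj r)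
  _≟ₒ_ = Vecₚ.≡-dec (Maybeₚ.≡-dec (Listₚ.≡-dec Boolₚ._≟_))

  mem-ext : ∀ {r} {A B : Obj r} → (∀ i n → mem A i n ≡ mem B i n) → A ≡ B
  mem-ext {A = []ᵥ}     {[]ᵥ}     e = refl
  mem-ext {A = a ∷ᵥ A} {b ∷ᵥ B} e =
    cong₂ _∷ᵥ_ (∈-ext a b (e zero)) (mem-ext (λ i → e (suc i)))

  mem-∅ : ∀ {r} (i : Fin r) n → mem ∅ᵣ i n ≡ false
  mem-∅ i n rewrite Vecₚ.lookup-replicate i (nothing {A = List Bool}) = refl

  mem-∪ : ∀ {r} (A B : Obj r) i n → mem (A ∪ B) i n ≡ mem A i n ∨ mem B i n
  mem-∪ A B i n rewrite Vecₚ.lookup-zipWith _∪ₛ_ i A B = ∈-∪ₛ (lookup A i) (lookup B i) n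

  mem-∩ : ∀ {r} (A B : Obj r) i n → mem (A ∩ B) i n ≡ mem A i n ∧ mem B i n
  mem-∩ A B i n rewrite Vecₚ.lookup-zipWith _∩ₛ_ i A B = ∈-∩ₛ (lookup A i) (lookup B i) n

  -- Set identities that follow from other set identities are decided by checking all
  -- possible membership patterns of a point.

  infixl 6 _:∪_
  infixl 7 _:∩_
  infix  4 _:≡_

  data SetExpr (k : ℕ) : Set where
    var       : Fin k → SetExpr k
    :∅        : SetExpr k
    _:∪_ _:∩_ : SetExpr k → SetExpr k → SetExpr k

  data SetEqn (k : ℕ) : Set where
    _:≡_ : SetExpr k → SetExpr k → SetEqn k

  evalBool : ∀ {k} → SetExpr k → Vec Bool k → Bool
  evalBool (var x)  β = lookup β x
  evalBool :∅       β = false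
  evalBool (d :∪ e) β = evalBool d β ∨ evalBool e β
  evalBool (d :∩ e) β = evalBool d β ∧ evalBool e β

  infix 4 _≡ᵇ_
  _≡ᵇ_ : Bool → Bool → Bool
  true  ≡ᵇ b = b
  false ≡ᵇ b = not b

  ≡ᵇ-refl : ∀ b → T (b ≡ᵇ b)
  ≡ᵇ-refl true  = tt
  ≡ᵇ-refl false = tt

  ≡ᵇ⇒≡ : ∀ a b → T (a ≡ᵇ b) → a ≡ b
  ≡ᵇ⇒≡ true  true  _ = refl
  ≡ᵇ⇒≡ false false _ = refl

  holdsBool : ∀ {k} → SetEqn k → Vec Bool k → Bool
  holdsBool (d :≡ e) β = evalBool d β ≡ᵇ evalBool e β

  entailsAt : ∀ {k} → List (SetEqn k) → SetEqn k → Vec Bool k → Bool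
  entailsAt []       goal β = holdsBool goal β
  entailsAt (h ∷ hs) goal β = if holdsBool h β then entailsAt hs goal β else true

  forAllBits : ∀ k → (Vec Bool k → Bool) → Bool
  forAllBits zero    φ = φ []ᵥ
  forAllBits (suc k) φ = forAllBits k (φ ∘ (true ∷ᵥ_)) ∧ forAllBits k (φ ∘ (false ∷ᵥ_))

  T-∧ : ∀ a {b} → T (a ∧ b) → T a × T b
  T-∧ true t = tt , t

  forAllBits-sound : ∀ k φ → T (forAllBits k φ) → ∀ β → T (φ β)
  forAllBits-sound zero    φ t []ᵥ          = t
  forAllBits-sound (suc k) φ t (true ∷ᵥ β)  = forAllBits-sound k _ (proj₁ (T-∧ _ t)) β
  forAllBits-sound (suc k) φ t (false ∷ᵥ β) =
    forAllBits-sound k _ (proj₂ (T-∧ (forAllBits k (φ ∘ (true ∷ᵥ_))) t)) β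

  module _ {r k : ℕ} (ρ : Vec (Obj r) k) where

    eval : SetExpr k → Obj r
    eval (var x)  = lookup ρ x
    eval :∅       = ∅ᵣ
    eval (d :∪ e) = eval d ∪ eval e
    eval (d :∩ e) = eval d ∩ eval e

    Holds : SetEqn k → Set
    Holds (d :≡ e) = eval d ≡ eval e

    module _ (i : Fin r) (n : ℕ) where

      pattern-at : Vec Bool k
      pattern-at = Vec.map (λ A → mem A i n) ρ

      mem-eval : ∀ e → mem (eval e) i n ≡ evalBool e pattern-at
      mem-eval (var x)  = sym (Vecₚ.lookup-map x (λ A → mem A i n) ρ)
      mem-eval :∅       = mem-∅ i n
      mem-eval (d :∪ e) = trans (mem-∪ (eval d) (eval e) i n) (cong₂ _∨_ (mem-eval d) (mem-eval e))
      mem-eval (d :∩ e) = trans (mem-∩ (eval d) (eval e) i n) (cong₂ _∧_ (mem-eval d) (mem-eval e))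

      holds⇒holdsBool : ∀ h → Holds h → T (holdsBool h pattern-at)
      holds⇒holdsBool (d :≡ e) eq =
        subst (λ b → T (evalBool d pattern-at ≡ᵇ b))
          (trans (sym (mem-eval d)) (trans (cong (λ A → mem A i n) eq) (mem-eval e))) (≡ᵇ-refl (evalBool d pattern-at))

      entailed : ∀ hs goal → T (entailsAt hs goal pattern-at) → All Holds hs → T (holdsBool goal pattern-at)
      entailed []       goal t []       = t
      entailed (h ∷ hs) goal t (p ∷ ps) with holdsBool h pattern-at | holds⇒holdsBool h p
      ... | true | _ = entailed hs goal t ps

    -- For a valid entailment the implicit argument computes to `⊤` and is filled in by itself, so
    -- the truth table is evaluated during type checking.
    setSolve : ∀ hs d e → {T (forAllBits k (entailsAt hs (d :≡ e)))} → All Holds hs → Holds (d :≡ e)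
    setSolve hs d e {t} ps = mem-ext λ i n → trans (mem-eval i n d) (trans
      (≡ᵇ⇒≡ _ _ (entailed i n hs (d :≡ e) (forAllBits-sound k _ t (pattern-at i n)) ps))
      (sym (mem-eval i n e)))

  -- Ranks, and morphisms between objects of equal sizes

  El′ : List Bool → Set
  El′ bs = Σ ℕ (λ n → T (bitAt bs n))

  El′-≡ : ∀ bs {x y : El′ bs} → proj₁ x ≡ proj₁ y → x ≡ y
  El′-≡ bs {n , s} {.n , t} refl = cong (n ,_) (Boolₚ.T-irrelevant s t)

  sucEl : ∀ {b bs} → El′ bs → El′ (b ∷ bs)
  sucEl (n , t) = suc n , t

  rank : ∀ bs → El′ bs → Fin (ones bs)
  rank (true  ∷ bs) (zero  , t) = zero
  rank (true  ∷ bs) (suc n , t) = suc (rank bs (n , t))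
  rank (false ∷ bs) (suc n , t) = rank bs (n , t)

  unrank : ∀ bs → Fin (ones bs) → El′ bs
  unrank (true  ∷ bs) zero    = zero , tt
  unrank (true  ∷ bs) (suc k) = sucEl {true} {bs} (unrank bs k)
  unrank (false ∷ bs) k       = sucEl {false} {bs} (unrank bs k)

  rank-unrank : ∀ bs k → rank bs (unrank bs k) ≡ k
  rank-unrank (true  ∷ bs) zero    = refl
  rank-unrank (true  ∷ bs) (suc k) = cong suc (rank-unrank bs k)
  rank-unrank (false ∷ bs) k       = rank-unrank bs k

  unrank-rank : ∀ bs x → unrank bs (rank bs x) ≡ x
  unrank-rank (true  ∷ bs) (zero  , t) = refl
  unrank-rank (true  ∷ bs) (suc n , t) = cong (sucEl {true} {bs}) (unrank-rank bs (n , t))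
  unrank-rank (false ∷ bs) (suc n , t) = cong (sucEl {false} {bs}) (unrank-rank bs (n , t))

  El↔Fin : ∀ A → El A ↔ Fin (ones (toBits A))
  El↔Fin A = mk↔ₛ′ (rank (toBits A)) (unrank (toBits A)) (rank-unrank (toBits A)) (unrank-rank (toBits A))

  module _ {r : ℕ} where

    homOfSizes : {Ω Ω' : Obj r} →
      (∀ i → ones (toBits (lookup Ω i)) ≡ ones (toBits (lookup Ω' i))) → Hom Ω Ω'
    homOfSizes {Ω} {Ω'} e = hom λ i → ↔-trans (El↔Fin (lookup Ω i))
      (subst (λ k → Fin k ↔ El (lookup Ω' i)) (sym (e i)) (↔-sym (El↔Fin (lookup Ω' i))))

    symHom : {Ω Ω' : Obj r} → Hom Ω Ω' → Hom Ω' Ω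
    symHom f = hom λ i → ↔-sym (comp f i)

    castHom : {Ω Ω' : Obj r} → Ω ≡ Ω' → Hom Ω Ω'
    castHom {Ω} refl = idHom Ω

    castHom-label : {Ω Ω' : Obj r} (p : Ω ≡ Ω') → ∀ i x → proj₁ (Inverse.to (comp (castHom p) i) x) ≡ proj₁ x
    castHom-label refl i x = refl

  -- Images of subobjects under a morphism

  restrict : ∀ bs → (El′ bs → Bool) → List Bool
  restrict []           P = []
  restrict (true  ∷ bs) P = P (zero , tt) ∷ restrict bs (λ x → P (sucEl {true} {bs} x))
  restrict (false ∷ bs) P = false ∷ restrict bs (λ x → P (sucEl {false} {bs} x))

  bitAt-restrict : ∀ bs P x → bitAt (restrict bs P) (proj₁ x) ≡ P x
  bitAt-restrict (true  ∷ bs) P (zero  , t) = refl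
  bitAt-restrict (true  ∷ bs) P (suc n , t) = bitAt-restrict bs _ (n , t)
  bitAt-restrict (false ∷ bs) P (suc n , t) = bitAt-restrict bs _ (n , t)

  restrict-⊆ : ∀ bs P n → T (bitAt (restrict bs P) n) → T (bitAt bs n)
  restrict-⊆ (true  ∷ bs) P zero    t = tt
  restrict-⊆ (true  ∷ bs) P (suc n) t = restrict-⊆ bs _ n t
  restrict-⊆ (false ∷ bs) P (suc n) t = restrict-⊆ bs _ n t

  _⊆ₛ_ : FinSet → FinSet → Set
  A ⊆ₛ B = ∀ n → T (n ∈? A) → T (n ∈? B)

  module _ (A B : FinSet) (e : El A ↔ El B) where
    open Inverse e

    -- The direct image, obtained as the preimage under the inverse bijection, so that membership is
    -- a Boolean test at each point of B.
    imageBits : FinSet → List Bool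
    imageBits I = restrict (toBits B) (λ y → proj₁ (from y) ∈? I)

    imageₛ : FinSet → FinSet
    imageₛ I = fromBits (imageBits I)

    ∈-imageₛ : ∀ I (y : El B) → proj₁ y ∈? imageₛ I ≡ proj₁ (from y) ∈? I
    ∈-imageₛ I y = trans (bitAt-fromBits (imageBits I) (proj₁ y)) (bitAt-restrict (toBits B) (λ y → proj₁ (from y) ∈? I) y)

    imageₛ-⊆ : ∀ I → imageₛ I ⊆ₛ B
    imageₛ-⊆ I n t = restrict-⊆ (toBits B) (λ y → proj₁ (from y) ∈? I) n (subst T (bitAt-fromBits (imageBits I) n) t)

    restrict↔ : ∀ I → I ⊆ₛ A → El I ↔ El (imageₛ I)
    restrict↔ I I⊆A = mk↔ₛ′ to′ from′ to′∘from′ from′∘to′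
      where
      to′ : El I → El (imageₛ I)
      to′ (n , t) = proj₁ y , subst T (sym (trans (∈-imageₛ I y) (cong (λ x → proj₁ x ∈? I) (strictlyInverseʳ (n , I⊆A n t))))) t
        where y = to (n , I⊆A n t)

      from′ : El (imageₛ I) → El I
      from′ (m , t) = proj₁ (from y) , subst T (∈-imageₛ I y) t
        where y = m , imageₛ-⊆ I m t

      to′∘from′ : ∀ y → to′ (from′ y) ≡ y
      to′∘from′ (m , t) = El′-≡ (toBits (imageₛ I)) (trans (cong (proj₁ ∘ to) (El′-≡ (toBits A) refl)) (cong proj₁ (strictlyInverseˡ (m , imageₛ-⊆ I m t))))

      from′∘to′ : ∀ x → from′ (to′ x) ≡ x
      from′∘to′ (n , t) = El′-≡ (toBits I) (trans (cong (proj₁ ∘ from) (El′-≡ (toBits B) refl)) (cong proj₁ (strictlyInverseʳ (n , I⊆A n t))))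

  subst-label : ∀ A {B B'} (p : B ≡ B') (e : El A ↔ El B) x →
    proj₁ (Inverse.to (subst (λ X → El A ↔ El X) p e) x) ≡ proj₁ (Inverse.to e x)
  subst-label A refl e x = refl

  T? : ∀ b → T b ⊎ b ≡ false
  T? true  = inj₁ tt
  T? false = inj₂ refl

  T-true : ∀ {b} → T b → b ≡ true
  T-true {true} _ = refl

  ¬T-false : ∀ {b} → ¬ T b → b ≡ false
  ¬T-false {true}  ¬t = ⊥-elim (¬t tt)
  ¬T-false {false} ¬t = refl

  T-∨ˡ : ∀ {a b} → T a → T (a ∨ b)
  T-∨ˡ {true} _ = tt

  T-∨ʳ : ∀ {a b} → T b → T (a ∨ b)
  T-∨ʳ {true}  t = tt
  T-∨ʳ {false} t = t

  module Image {r : ℕ} {Ω Ω' : Obj r} (f : Hom Ω Ω') where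

    image : Obj r → Obj r
    image I = tabulate (λ i → imageₛ (lookup Ω i) (lookup Ω' i) (comp f i) (lookup I i))

    lookup-image : ∀ I i → lookup (image I) i ≡ imageₛ (lookup Ω i) (lookup Ω' i) (comp f i) (lookup I i)
    lookup-image I i = Vecₚ.lookup∘tabulate _ i

    restrictHom : ∀ I → (∀ i → lookup I i ⊆ₛ lookup Ω i) → Hom I (image I)
    restrictHom I I⊆Ω = hom λ i → subst (λ A → El (lookup I i) ↔ El A) (sym (lookup-image I i))
      (restrict↔ (lookup Ω i) (lookup Ω' i) (comp f i) (lookup I i) (I⊆Ω i))

    restrictHom-label : ∀ I (I⊆Ω : ∀ i → lookup I i ⊆ₛ lookup Ω i) i (x : El (lookup I i)) →
      proj₁ (Inverse.to (comp (restrictHom I I⊆Ω) i) x) ≡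
      proj₁ (Inverse.to (comp f i) (proj₁ x , I⊆Ω i (proj₁ x) (proj₂ x)))
    restrictHom-label I I⊆Ω i x = subst-label (lookup I i) (sym (lookup-image I i)) _ x

    mem-image : ∀ I i (y : El (lookup Ω' i)) →
      mem (image I) i (proj₁ y) ≡ mem I i (proj₁ (Inverse.from (comp f i) y))
    mem-image I i y rewrite lookup-image I i = ∈-imageₛ (lookup Ω i) (lookup Ω' i) (comp f i) (lookup I i) y

    mem-image-outside : ∀ I i n → mem Ω' i n ≡ false → mem (image I) i n ≡ false
    mem-image-outside I i n e rewrite lookup-image I i =
      ¬T-false (λ t → subst T e (imageₛ-⊆ (lookup Ω i) (lookup Ω' i) (comp f i) (lookup I i) n t))

    module _ {I J : Obj r} (d : Disjoint I J) (p : I ∪ J ≡ Ω) where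

      ⊆ˡ : ∀ i → lookup I i ⊆ₛ lookup Ω i
      ⊆ˡ i n t = subst T (trans (sym (mem-∪ I J i n)) (cong (λ A → mem A i n) p)) (T-∨ˡ t)

      ⊆ʳ : ∀ i → lookup J i ⊆ₛ lookup Ω i
      ⊆ʳ i n t = subst T (trans (sym (mem-∪ I J i n)) (cong (λ A → mem A i n) p)) (T-∨ʳ {mem I i n} t)

      image-disjoint : Disjoint (image I) (image J)
      image-disjoint = mem-ext λ i n → trans (mem-∩ (image I) (image J) i n) (trans (go i n (T? (mem Ω' i n))) (sym (mem-∅ i n)))
        where
        go : ∀ i n → T (mem Ω' i n) ⊎ mem Ω' i n ≡ false → mem (image I) i n ∧ mem (image J) i n ≡ false
        go i n (inj₂ e) = cong₂ _∧_ (mem-image-outside I i n e) (mem-image-outside J i n e)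
        go i n (inj₁ t) = trans (cong₂ _∧_ (mem-image I i (n , t)) (mem-image J i (n , t)))
          (trans (sym (mem-∩ I J i m)) (trans (cong (λ A → mem A i m) d) (mem-∅ i m)))
          where m = proj₁ (Inverse.from (comp f i) (n , t))

      image-∪ : image I ∪ image J ≡ Ω'
      image-∪ = mem-ext λ i n → trans (mem-∪ (image I) (image J) i n) (go i n (T? (mem Ω' i n)))
        where
        go : ∀ i n → T (mem Ω' i n) ⊎ mem Ω' i n ≡ false → mem (image I) i n ∨ mem (image J) i n ≡ mem Ω' i n
        go i n (inj₂ e) = trans (cong₂ _∨_ (mem-image-outside I i n e) (mem-image-outside J i n e)) (sym e)
        go i n (inj₁ t) = trans (cong₂ _∨_ (mem-image I i (n , t)) (mem-image J i (n , t)))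
          (trans (sym (mem-∪ I J i (proj₁ m))) (trans (cong (λ A → mem A i (proj₁ m)) p)
            (trans (T-true (proj₂ m)) (sym (T-true t)))))
          where m = Inverse.from (comp f i) (n , t)

    hom-reflects-∅ : Ω' ≡ ∅ᵣ → Ω ≡ ∅ᵣ
    hom-reflects-∅ refl = mem-ext λ i n → trans
      (¬T-false (λ t → let (m , s) = Inverse.to (comp f i) (n , t) in subst T (mem-∅ i m) s)) (sym (mem-∅ i n))

  -- Translation by one more than the largest element: a disjoint copy of A, on which a second copy
  -- of a structure can live.
  shift : FinSet → FinSet
  shift A = fromBits (replicate (length (toBits A)) false ++ toBits A)

  ones-shift : ∀ A → ones (toBits (shift A)) ≡ ones (toBits A)
  ones-shift A = trans (ones-fromBits (replicate (length (toBits A)) false ++ toBits A)) (go (length (toBits A)))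
    where
    go : ∀ k → ones (replicate k false ++ toBits A) ≡ ones (toBits A)
    go zero    = refl
    go (suc k) = go k

  shift-disjoint : ∀ A n → (n ∈? A) ∧ (n ∈? shift A) ≡ false
  shift-disjoint A n = trans (cong ((n ∈? A) ∧_) (bitAt-fromBits (replicate (length (toBits A)) false ++ toBits A) n)) (go (toBits A) (toBits A) n)
    where
    go : ∀ bs cs n → bitAt bs n ∧ bitAt (replicate (length bs) false ++ cs) n ≡ false
    go []           cs n       = refl
    go (b     ∷ bs) cs (suc n) = go bs cs n
    go (true  ∷ bs) cs zero    = refl
    go (false ∷ bs) cs zero    = refl

  shiftObj : ∀ {r} → Obj r → Obj r
  shiftObj = Vec.map shift

  shiftObj-disjoint : ∀ {r} (Ω : Obj r) → Disjoint Ω (shiftObj Ω)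
  shiftObj-disjoint Ω = mem-ext λ i n → trans (mem-∩ Ω (shiftObj Ω) i n) (trans
    (trans (cong (λ A → mem Ω i n ∧ (n ∈? A)) (Vecₚ.lookup-map i shift Ω)) (shift-disjoint (lookup Ω i) n))
    (sym (mem-∅ i n)))

  shiftHom : ∀ {r} (Ω : Obj r) → Hom Ω (shiftObj Ω)
  shiftHom Ω = homOfSizes λ i → sym (trans (cong (ones ∘ toBits) (Vecₚ.lookup-map i shift Ω)) (ones-shift (lookup Ω i)))

  -- Subobjects of ([n₁],...,[n_r])

  box : ∀ {n} → Vec Bool n → FinSet
  box v = fromBits (false ∷ toList v)

  ∈-box : ∀ {n} (v : Vec Bool n) m → m ∈? box v ≡ bitAt (false ∷ toList v) m
  ∈-box v = bitAt-fromBits (false ∷ toList v)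

  toObj : ∀ {r} (n : Vec ℕ r) → Subs n → Obj r
  toObj []ᵥ       tt      = []ᵥ
  toObj (n ∷ᵥ ns) (v , s) = box v ∷ᵥ toObj ns s

  boxObj : ∀ {r} → Vec ℕ r → Obj r
  boxObj = Vec.map ⟦_⟧

  box-disjoint : ∀ {n} (v : Vec Bool n) → box v ∩ₛ box (Vec.map not v) ≡ nothing
  box-disjoint v = ∈-ext (box v ∩ₛ box (Vec.map not v)) nothing λ m → trans
    (∈-∩ₛ (box v) (box (Vec.map not v)) m)
    (trans (cong₂ _∧_ (∈-box v m) (∈-box (Vec.map not v) m)) (head v m))
    where
    go : ∀ {n} (v : Vec Bool n) m → bitAt (toList v) m ∧ bitAt (toList (Vec.map not v)) m ≡ false
    go []ᵥ          m       = refl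
    go (true  ∷ᵥ v) zero    = refl
    go (false ∷ᵥ v) zero    = refl
    go (b     ∷ᵥ v) (suc m) = go v m

    head : ∀ {n} (v : Vec Bool n) m → bitAt (false ∷ toList v) m ∧ bitAt (false ∷ toList (Vec.map not v)) m ≡ false
    head v zero    = refl
    head v (suc m) = go v m

  box-∪ : ∀ {n} (v : Vec Bool n) → box v ∪ₛ box (Vec.map not v) ≡ ⟦ n ⟧
  box-∪ {n} v = ∈-ext (box v ∪ₛ box (Vec.map not v)) ⟦ n ⟧ λ m → trans
    (∈-∪ₛ (box v) (box (Vec.map not v)) m)
    (trans (cong₂ _∨_ (∈-box v m) (∈-box (Vec.map not v) m))
      (trans (head v m) (sym (bitAt-fromBits (false ∷ replicate n true) m))))
    where
    go : ∀ {n} (v : Vec Bool n) m → bitAt (toList v) m ∨ bitAt (toList (Vec.map not v)) m ≡ bitAt (replicate n true) m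
    go []ᵥ          m       = refl
    go (true  ∷ᵥ v) zero    = refl
    go (false ∷ᵥ v) zero    = refl
    go (b     ∷ᵥ v) (suc m) = go v m

    head : ∀ {n} (v : Vec Bool n) m → bitAt (false ∷ toList v) m ∨ bitAt (false ∷ toList (Vec.map not v)) m ≡ bitAt (false ∷ replicate n true) m
    head v zero    = refl
    head v (suc m) = go v m

  box-injective : ∀ {n} (u v : Vec Bool n) → box u ≡ box v → u ≡ v
  box-injective u v e = go u v λ m →
    trans (sym (∈-box u (suc m))) (trans (cong (suc m ∈?_) e) (∈-box v (suc m)))
    where
    go : ∀ {n} (u v : Vec Bool n) → (∀ m → bitAt (toList u) m ≡ bitAt (toList v) m) → u ≡ v
    go []ᵥ       []ᵥ       e = refl
    go (a ∷ᵥ u) (b ∷ᵥ v) e = cong₂ _∷ᵥ_ (e 0) (go u v (e ∘ suc))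

  ∨-falseˡ : ∀ a {b} → a ∨ b ≡ false → a ≡ false
  ∨-falseˡ false _ = refl

  box-surjective : ∀ {n} A B → A ∪ₛ B ≡ ⟦ n ⟧ → Σ[ v ∈ Vec Bool n ] box v ≡ A
  box-surjective {n} A B e = proj₁ tail , ∈-ext (box (proj₁ tail)) A λ m → trans (∈-box (proj₁ tail) m) (head m)
    where
    bits : ∀ m → (m ∈? A) ∨ (m ∈? B) ≡ bitAt (false ∷ replicate n true) m
    bits m = trans (sym (∈-∪ₛ A B m)) (trans (cong (m ∈?_) e) (bitAt-fromBits (false ∷ replicate n true) m))

    go : ∀ n (P Q : ℕ → Bool) → (∀ m → P m ∨ Q m ≡ bitAt (replicate n true) m) →
         Σ[ v ∈ Vec Bool n ] (∀ m → bitAt (toList v) m ≡ P m)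
    go zero    P Q e = []ᵥ , λ m → sym (∨-falseˡ (P m) (e m))
    go (suc n) P Q e with go n (P ∘ suc) (Q ∘ suc) (e ∘ suc)
    ... | v , eq = P 0 ∷ᵥ v , λ { zero → refl ; (suc m) → eq m }

    tail : Σ[ v ∈ Vec Bool n ] (∀ m → bitAt (toList v) m ≡ suc m ∈? A)
    tail = go n (λ m → suc m ∈? A) (λ m → suc m ∈? B) (bits ∘ suc)

    head : ∀ m → bitAt (false ∷ toList (proj₁ tail)) m ≡ m ∈? A
    head zero    = sym (∨-falseˡ (0 ∈? A) (bits 0))
    head (suc m) = proj₂ tail m

  toObj-disjoint : ∀ {r} (n : Vec ℕ r) s → Disjoint (toObj n s) (toObj n (complement n s))
  toObj-disjoint []ᵥ       tt      = refl
  toObj-disjoint (n ∷ᵥ ns) (v , s) = cong₂ _∷ᵥ_ (box-disjoint v) (toObj-disjoint ns s)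

  toObj-∪ : ∀ {r} (n : Vec ℕ r) s → toObj n s ∪ toObj n (complement n s) ≡ boxObj n
  toObj-∪ []ᵥ       tt      = refl
  toObj-∪ (n ∷ᵥ ns) (v , s) = cong₂ _∷ᵥ_ (box-∪ v) (toObj-∪ ns s)

  toObj-injective : ∀ {r} (n : Vec ℕ r) s t → toObj n s ≡ toObj n t → s ≡ t
  toObj-injective []ᵥ       tt      tt      e = refl
  toObj-injective (n ∷ᵥ ns) (u , s) (v , t) e =
    cong₂ _,_ (box-injective u v (Vecₚ.∷-injectiveˡ e)) (toObj-injective ns s t (Vecₚ.∷-injectiveʳ e))

  -- Containment of I in the box is expressed by a partner J, which is the form in which
  -- decompositions supply it.
  toObj-surjective : ∀ {r} (n : Vec ℕ r) (I J : Obj r) → I ∪ J ≡ boxObj n → Σ[ s ∈ Subs n ] toObj n s ≡ I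
  toObj-surjective []ᵥ       []ᵥ      []ᵥ      e = tt , refl
  toObj-surjective (n ∷ᵥ ns) (A ∷ᵥ I) (B ∷ᵥ J) e
    with box-surjective A B (Vecₚ.∷-injectiveˡ e) | toObj-surjective ns I J (Vecₚ.∷-injectiveʳ e)
  ... | v , p | s , q = (v , s) , cong₂ _∷ᵥ_ p q

  ∈-allBits : ∀ {n} (v : Vec Bool n) → v ∈ allBits n
  ∈-allBits []ᵥ                = here refl
  ∈-allBits (true ∷ᵥ v)        = ∈-++⁺ˡ (∈-map⁺ (true ∷ᵥ_) (∈-allBits v))
  ∈-allBits {suc n} (false ∷ᵥ v) = ∈-++⁺ʳ (List.map (true ∷ᵥ_) (allBits n)) (∈-map⁺ (false ∷ᵥ_) (∈-allBits v))

  ∈-allSubs : ∀ {r} (n : Vec ℕ r) s → s ∈ allSubs n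
  ∈-allSubs []ᵥ       tt      = here refl
  ∈-allSubs (n ∷ᵥ ns) (v , s) = ∈-concatMap⁺ (λ u → List.map (u ,_) (allSubs ns))
    (Any.map (λ { refl → ∈-map⁺ (v ,_) (∈-allSubs ns s) }) (∈-allBits v))

  ones-replicate : ∀ n → ones (replicate n true) ≡ n
  ones-replicate zero    = refl
  ones-replicate (suc n) = cong suc (ones-replicate n)

  toObj-sizes : ∀ {r} (n : Vec ℕ r) s i →
    ones (toBits (lookup (toObj n s) i)) ≡ ones (toBits (lookup (boxObj (sizes n s)) i))
  toObj-sizes (n ∷ᵥ ns) (v , s) zero    = trans (ones-fromBits (false ∷ toList v))
    (sym (trans (ones-fromBits (false ∷ replicate (ones (toList v)) true)) (ones-replicate (ones (toList v)))))
  toObj-sizes (n ∷ᵥ ns) (v , s) (suc i) = toObj-sizes ns s i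

  toObjHom : ∀ {r} (n : Vec ℕ r) s → Hom (toObj n s) (boxObj (sizes n s))
  toObjHom n s = homOfSizes (toObj-sizes n s)

  full : ∀ {r} (n : Vec ℕ r) → Subs n
  full []ᵥ       = tt
  full (n ∷ᵥ ns) = Vec.replicate n true , full ns

  sizes-full : ∀ {r} (n : Vec ℕ r) → sizes n (full n) ≡ n
  sizes-full []ᵥ       = refl
  sizes-full (n ∷ᵥ ns) = cong₂ _∷ᵥ_ (trans (cong ones (Vecₚ.toList-replicate n true)) (ones-replicate n)) (sizes-full ns)

  toObj-full : ∀ {r} (n : Vec ℕ r) → toObj n (full n) ≡ boxObj n
  toObj-full []ᵥ       = refl
  toObj-full (n ∷ᵥ ns) = cong₂ _∷ᵥ_ (cong (λ bs → fromBits (false ∷ bs)) (Vecₚ.toList-replicate n true)) (toObj-full ns)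

  -- Pigeonhole: if y were missed, `punchOut` at y would inject `Fin (suc n)` into `Fin n`.
  injective⇒surjective : ∀ {n} (f : Fin n → Fin n) → (∀ {i j} → f i ≡ f j → i ≡ j) → ∀ y → ∃ λ x → f x ≡ y
  injective⇒surjective {suc n} f f-inj y with Finₚ.any? (λ x → f x Finₚ.≟ y)
  ... | yes hit  = hit
  ... | no  miss = ⊥-elim (ℕₚ.1+n≰n (Finₚ.injective⇒≤ {f = λ x → punchOut (λ e → miss (x , sym e))}
                     (λ e → f-inj (Finₚ.punchOut-injective (λ e → miss (_ , sym e)) (λ e → miss (_ , sym e)) e))))

open LabelSets

-- Decompositions of a structure

pattern x₀ = var zero
pattern x₁ = var (suc zero)
pattern x₂ = var (suc (suc zero))
pattern x₃ = var (suc (suc (suc zero)))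

module Decompositions {r : ℕ} {S : Species r} (N : NatTrans S) where
  open ≡ using (refl; sym; trans; cong; cong₂; subst; subst-subst-sym; subst-sym-subst)
  open Species S
  open NatTrans N

  -- Finiteness of F[Ω] and cuts of a structure

  _≟F_ : ∀ {Ω} → DecidableEquality (F₀ Ω)
  _≟F_ {Ω} x y with Inverse.to (enum Ω) x Finₚ.≟ Inverse.to (enum Ω) y
  ... | yes e = yes (trans (sym (Inverse.strictlyInverseʳ (enum Ω) x)) (trans (cong (Inverse.from (enum Ω)) e) (Inverse.strictlyInverseʳ (enum Ω) y)))
  ... | no ¬e = no (λ e → ¬e (cong (Inverse.to (enum Ω)) e))

  anyF? : ∀ {Ω} {P : F₀ Ω → Set} → (∀ x → Dec (P x)) → Dec (Σ (F₀ Ω) P)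
  anyF? {Ω} {P} P? = map′ (λ (i , p) → Inverse.from (enum Ω) i , p)
    (λ (x , p) → Inverse.to (enum Ω) x , subst P (sym (Inverse.strictlyInverseʳ (enum Ω) x)) p)
    (Finₚ.any? (λ i → P? (Inverse.from (enum Ω) i)))

  injectiveF⇒surjective : ∀ {Ω} (f : F₀ Ω → F₀ Ω) → (∀ {x y} → f x ≡ f y → x ≡ y) → ∀ y → ∃ λ x → f x ≡ y
  injectiveF⇒surjective {Ω} f f-inj y =
    let open Inverse (enum Ω)
        from-inj : ∀ {i j} → from i ≡ from j → i ≡ j
        from-inj {i} {j} e = trans (sym (strictlyInverseˡ i)) (trans (cong to e) (strictlyInverseˡ j))
        to-inj : ∀ {x y} → to x ≡ to y → x ≡ y
        to-inj {x} {y} e = trans (sym (strictlyInverseʳ x)) (trans (cong from e) (strictlyInverseʳ y))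
        i , e = injective⇒surjective (to ∘ f ∘ from) (λ e → from-inj (f-inj (to-inj e))) (to y)
    in from i , to-inj e

  subst-F₁ : ∀ {Ω Ω'} (p : Ω ≡ Ω') (x : F₀ Ω') → subst F₀ p (F₁ (castHom (sym p)) x) ≡ x
  subst-F₁ refl x = F-id x

  F₁-inverseˡ : ∀ {Ω Ω'} (f : Hom Ω Ω') x → F₁ (symHom f) (F₁ f x) ≡ x
  F₁-inverseˡ f x = trans (sym (F-∘ (symHom f) f x))
    (trans (F-cong (λ i z → Inverse.strictlyInverseʳ (comp f i) z) x) (F-id x))

  F₁-inverseʳ : ∀ {Ω Ω'} (f : Hom Ω Ω') y → F₁ f (F₁ (symHom f) y) ≡ y
  F₁-inverseʳ f y = trans (sym (F-∘ f (symHom f) y))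
    (trans (F-cong (λ i z → Inverse.strictlyInverseˡ (comp f i) z) y) (F-id y))

  -- The relation x = η(a, b). Keeping the transport along I ∪ J = Ω inside the record frees the
  -- statements about cuts of a fixed Ω from transports.
  record Comp (I J Ω : Obj r) (a : F₀ I) (b : F₀ J) (x : F₀ Ω) : Set where
    constructor mkComp
    field
      disjoint : Disjoint I J
      union    : I ∪ J ≡ Ω
      η≡       : subst F₀ union (η I J disjoint a b) ≡ x

  IsDec : (I J Ω : Obj r) → F₀ Ω → Set
  IsDec I J Ω x = Σ[ a ∈ F₀ I ] Σ[ b ∈ F₀ J ] Comp I J Ω a b x

  Comp? : ∀ I J Ω a b x → Dec (Comp I J Ω a b x)
  Comp? I J Ω a b x with (I ∩ J) ≟ₒ ∅ᵣ | (I ∪ J) ≟ₒ Ω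
  ... | no ¬d | _     = no (λ (mkComp d _ _) → ¬d d)
  ... | yes d | no ¬p = no (λ (mkComp _ p _) → ¬p p)
  ... | yes d | yes refl = map′ (mkComp d refl) (λ { (mkComp _ refl e) → e }) (η I J d a b ≟F x)

  IsDec? : ∀ I J Ω x → Dec (IsDec I J Ω x)
  IsDec? I J Ω x = anyF? (λ a → anyF? (λ b → Comp? I J Ω a b x))

  comp-injective : ∀ {I J Ω a b a' b' x} → Comp I J Ω a b x → Comp I J Ω a' b' x → a ≡ a' × b ≡ b'
  comp-injective (mkComp d refl e) (mkComp _ refl e') = η-inj d _ _ _ _ (trans e (sym e'))

  comp-functional : ∀ {I J Ω a b x y} → Comp I J Ω a b x → Comp I J Ω a b y → x ≡ y
  comp-functional (mkComp _ refl e) (mkComp _ refl e') = trans (sym e) e'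

  η-subst : ∀ {X Y I J : Obj r} (e₁ : X ≡ I) (e₂ : Y ≡ J) (q : X ∪ Y ≡ I ∪ J) .(d : Disjoint X Y) .(d' : Disjoint I J) u v →
            subst F₀ q (η X Y d u v) ≡ η I J d' (subst F₀ e₁ u) (subst F₀ e₂ v)
  η-subst refl refl refl d d' u v = refl

  -- Naturality for the two restrictions of f carries a cut of x along (I, J) to a cut of F[f](x)
  -- along the images. With the inverse of f as well, it shows that F_η is stable under morphisms.
  indecomposable-reflect : ∀ {Ω Ω'} (f : Hom Ω Ω') x → IsIndecomposable N Ω' (F₁ f x) → IsIndecomposable N Ω x
  indecomposable-reflect {Ω} {Ω'} f x (Ω'≢∅ , indec) = (λ Ω≡∅ → Ω'≢∅ (Image.hom-reflects-∅ (symHom f) Ω≡∅)) , λ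
    { (I , J , d , p , I≢∅ , J≢∅ , a , b , e) → indec
      (image I , image J , image-disjoint d p , image-∪ d p ,
       (λ e → I≢∅ (Image.hom-reflects-∅ (f₁ d p) e)) , (λ e → J≢∅ (Image.hom-reflects-∅ (f₂ d p) e)) ,
       F₁ (f₁ d p) a , F₁ (f₂ d p) b , transported d p a b e) }
    where
    open Image f
    f₁ : ∀ {I J} (d : Disjoint I J) (p : I ∪ J ≡ Ω) → Hom I (image I)
    f₁ {I} d p = restrictHom I (⊆ˡ d p)
    f₂ : ∀ {I J} (d : Disjoint I J) (p : I ∪ J ≡ Ω) → Hom J (image J)
    f₂ {I} {J} d p = restrictHom J (⊆ʳ d p)

    transported : ∀ {I J} (d : Disjoint I J) (p : I ∪ J ≡ Ω) a b → subst F₀ p (η I J d a b) ≡ x →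
      subst F₀ (image-∪ d p) (η (image I) (image J) (image-disjoint d p) (F₁ (f₁ d p) a) (F₁ (f₂ d p) b)) ≡ F₁ f x
    transported {I} {J} d refl a b refl = trans
      (cong (subst F₀ (image-∪ d refl)) (trans
        -- Naturality ends in F of the union of the images, which equals Ω' only up to a proof;
        -- hence f is followed by `castHom`.
        (natural d (image-disjoint d refl) (f₁ d refl) (f₂ d refl) (castHom (sym (image-∪ d refl)) ∘H f) (left , right) a b)
        (F-∘ _ f _)))
      (subst-F₁ (image-∪ d refl) _)
      where
      left : ∀ i (y : El (lookup (I ∪ J) i)) (z : El (lookup I i)) → proj₁ y ≡ proj₁ z →
        proj₁ (Inverse.to (comp (castHom (sym (image-∪ d refl)) ∘H f) i) y) ≡ proj₁ (Inverse.to (comp (f₁ d refl) i) z)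
      left i y z e = trans (castHom-label (sym (image-∪ d refl)) i _)
        (trans (cong (proj₁ ∘ Inverse.to (comp f i)) (El′-≡ (toBits (lookup (I ∪ J) i)) e))
          (sym (restrictHom-label I (⊆ˡ d refl) i z)))
      right : ∀ i (y : El (lookup (I ∪ J) i)) (z : El (lookup J i)) → proj₁ y ≡ proj₁ z →
        proj₁ (Inverse.to (comp (castHom (sym (image-∪ d refl)) ∘H f) i) y) ≡ proj₁ (Inverse.to (comp (f₂ d refl) i) z)
      right i y z e = trans (castHom-label (sym (image-∪ d refl)) i _)
        (trans (cong (proj₁ ∘ Inverse.to (comp f i)) (El′-≡ (toBits (lookup (I ∪ J) i)) e))
          (sym (restrictHom-label J (⊆ʳ d refl) i z)))

  -- Consequences of (D1): splitting, merging and trivial cuts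

  module _ (D1 : IsCompositionOperator N) where

    module _ {I J K L : Obj r} (dIJ : Disjoint I J) (dKL : Disjoint K L) (p : I ∪ J ≡ K ∪ L) where

      private
        d₁ : Disjoint (I ∩ K) (I ∩ L)
        d₁ = setSolve (I ∷ᵥ K ∷ᵥ L ∷ᵥ []ᵥ) ((x₁ :∩ x₂ :≡ :∅) ∷ []) ((x₀ :∩ x₁) :∩ (x₀ :∩ x₂)) :∅ (dKL ∷ [])
        d₂ : Disjoint (J ∩ K) (J ∩ L)
        d₂ = setSolve (J ∷ᵥ K ∷ᵥ L ∷ᵥ []ᵥ) ((x₁ :∩ x₂ :≡ :∅) ∷ []) ((x₀ :∩ x₁) :∩ (x₀ :∩ x₂)) :∅ (dKL ∷ [])
        e₁ : (I ∩ K) ∪ (I ∩ L) ≡ I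
        e₁ = setSolve (I ∷ᵥ J ∷ᵥ K ∷ᵥ L ∷ᵥ []ᵥ) ((x₀ :∪ x₁ :≡ x₂ :∪ x₃) ∷ []) ((x₀ :∩ x₂) :∪ (x₀ :∩ x₃)) x₀ (p ∷ [])
        e₂ : (J ∩ K) ∪ (J ∩ L) ≡ J
        e₂ = setSolve (I ∷ᵥ J ∷ᵥ K ∷ᵥ L ∷ᵥ []ᵥ) ((x₀ :∪ x₁ :≡ x₂ :∪ x₃) ∷ []) ((x₁ :∩ x₂) :∪ (x₁ :∩ x₃)) x₁ (p ∷ [])
        d₁₂ : Disjoint ((I ∩ K) ∪ (I ∩ L)) ((J ∩ K) ∪ (J ∩ L))
        d₁₂ = trans (cong₂ _∩_ e₁ e₂) dIJ
        q : ((I ∩ K) ∪ (I ∩ L)) ∪ ((J ∩ K) ∪ (J ∩ L)) ≡ I ∪ J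
        q = cong₂ _∪_ e₁ e₂

      -- The inclusion from left to right in (D1) writes η(a, b) as a product of two inner products;
      -- injectivity of η identifies these with a and b.
      D1-split : ∀ {a b c e} → η K L dKL c e ≡ subst F₀ p (η I J dIJ a b) →
                 IsDec (I ∩ K) (I ∩ L) I a × IsDec (J ∩ K) (J ∩ L) J b
      D1-split {a} {b} {c} {e} eq
        with proj₁ (D1 I J K L dIJ dKL p d₁ d₂ d₁₂ q (η I J dIJ a b)) ((a , b , refl) , (c , e , eq))
      ... | a' , b' , c' , e' , eq' with η-inj dIJ _ _ _ _ (trans (sym (η-subst e₁ e₂ q d₁₂ dIJ _ _)) eq')
      ... | eqa , eqb = (a' , b' , mkComp d₁ e₁ eqa) , (c' , e' , mkComp d₂ e₂ eqb)

      -- The inclusion from right to left in (D1).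
      D1-merge : ∀ {a b} → IsDec (I ∩ K) (I ∩ L) I a → IsDec (J ∩ K) (J ∩ L) J b →
                 InImage N K L dKL (subst F₀ p (η I J dIJ a b))
      D1-merge {a} {b} (a' , b' , mkComp d₁' e₁' eqa) (c' , e' , mkComp d₂' e₂' eqb) =
        proj₂ (proj₂ (D1 I J K L dIJ dKL p d₁ d₂ d₁₂ q (η I J dIJ a b))
          (a' , b' , c' , e' , trans (η-subst e₁' e₂' q d₁₂ dIJ _ _) (cong₂ (η I J dIJ) eqa eqb)))

    dec-split : ∀ {I J K L Ω a b x} → Comp I J Ω a b x → IsDec K L Ω x →
                IsDec (I ∩ K) (I ∩ L) I a × IsDec (J ∩ K) (J ∩ L) J b
    dec-split (mkComp d refl refl) (c , e , mkComp d' u eq) =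
      D1-split d d' (sym u) (trans (sym (subst-sym-subst u)) (cong (subst F₀ (sym u)) eq))

    -- The four pieces are given up to equations, so that simplified forms such as ∅ for I ∩ K can
    -- be supplied.
    dec-merge : ∀ {I J K L Ω A B C D a b x} → Comp I J Ω a b x → IsDec A B I a → IsDec C D J b →
                I ∩ K ≡ A → I ∩ L ≡ B → J ∩ K ≡ C → J ∩ L ≡ D → Disjoint K L → K ∪ L ≡ Ω → IsDec K L Ω x
    dec-merge (mkComp d refl refl) ab cd refl refl refl refl d' u with D1-merge d d' (sym u) ab cd
    ... | c , e , eq = c , e , mkComp d' u (trans (cong (subst F₀ u) eq) (subst-subst-sym u))

    -- Cut η(x, x′), for a disjoint copy x′ of x, by the decomposition that defines it.
    F∅-inhabited : Σ (Obj r) F₀ → F₀ ∅ᵣ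
    F∅-inhabited (Ω , x) =
      let h = mkComp (shiftObj-disjoint Ω) refl refl
          -- The cut is split by itself, so b lives on the intersection of Ω with its copy, which is
          -- empty.
          (_ , b , _) , _ = dec-split h (x , F₁ (shiftHom Ω) x , h)
      in subst F₀ (shiftObj-disjoint Ω) b

    module _ (point : F₀ ∅ᵣ) where

      ∅-disjointʳ : ∀ (Ω : Obj r) → Disjoint Ω ∅ᵣ
      ∅-disjointʳ Ω = setSolve (Ω ∷ᵥ []ᵥ) [] (x₀ :∩ :∅) :∅ []
      ∅-unionʳ : ∀ (Ω : Obj r) → Ω ∪ ∅ᵣ ≡ Ω
      ∅-unionʳ Ω = setSolve (Ω ∷ᵥ []ᵥ) [] (x₀ :∪ :∅) x₀ []
      ∅-disjointˡ : ∀ (Ω : Obj r) → Disjoint ∅ᵣ Ω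
      ∅-disjointˡ Ω = setSolve (Ω ∷ᵥ []ᵥ) [] (:∅ :∩ x₀) :∅ []
      ∅-unionˡ : ∀ (Ω : Obj r) → ∅ᵣ ∪ Ω ≡ Ω
      ∅-unionˡ Ω = setSolve (Ω ∷ᵥ []ᵥ) [] (:∅ :∪ x₀) x₀ []

      -- η(-, point) is an injective endomap of the finite set F[Ω], hence onto.
      dec-unitʳ : ∀ {Ω} (x : F₀ Ω) → Σ[ a ∈ F₀ Ω ] Comp Ω ∅ᵣ Ω a point x
      dec-unitʳ {Ω} x =
        let d = ∅-disjointʳ Ω
            u = ∅-unionʳ Ω
            a , e = injectiveF⇒surjective (λ a → subst F₀ u (η Ω ∅ᵣ d a point))
              (λ e → proj₁ (comp-injective (mkComp d u e) (mkComp d u refl))) x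
        in a , mkComp d u e

      dec-unitˡ : ∀ {Ω} (x : F₀ Ω) → Σ[ b ∈ F₀ Ω ] Comp ∅ᵣ Ω Ω point b x
      dec-unitˡ {Ω} x =
        let d = ∅-disjointˡ Ω
            u = ∅-unionˡ Ω
            b , e = injectiveF⇒surjective (λ b → subst F₀ u (η ∅ᵣ Ω d point b))
              (λ e → proj₂ (comp-injective (mkComp d u e) (mkComp d u refl))) x
        in b , mkComp d u e

      isDec-unitʳ : ∀ {Ω} (x : F₀ Ω) → IsDec Ω ∅ᵣ Ω x
      isDec-unitʳ x = let a , h = dec-unitʳ x in a , point , h

      isDec-unitˡ : ∀ {Ω} (x : F₀ Ω) → IsDec ∅ᵣ Ω Ω x
      isDec-unitˡ x = let b , h = dec-unitˡ x in point , b , h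

      -- η(x, x) also has the form η(a, point), as every element of F[∅ ∪ ∅] does; injectivity in
      -- the second argument gives x = point.
      F∅-unique : ∀ (x : F₀ ∅ᵣ) → x ≡ point
      F∅-unique x with dec-unitʳ (subst F₀ (∅-unionʳ ∅ᵣ) (η ∅ᵣ ∅ᵣ (∅-disjointʳ ∅ᵣ) x x))
      ... | a , h = proj₂ (comp-injective (mkComp (∅-disjointʳ ∅ᵣ) (∅-unionʳ ∅ᵣ) refl) h)

      -- Cut a as (∅, I) and b as (J, ∅). These are the four pieces that (D1) requires for the pairs
      -- (I, J) and (J, I), and merging them gives the cut (J, I).
      dec-comm : ∀ {I J Ω x} → IsDec I J Ω x → IsDec J I Ω x
      dec-comm {I} {J} {Ω} (a , b , h@(mkComp d u _)) = dec-merge h (isDec-unitˡ a) (isDec-unitʳ b) d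
        (setSolve (I ∷ᵥ []ᵥ) [] (x₀ :∩ x₀) x₀ [])
        (setSolve (J ∷ᵥ []ᵥ) [] (x₀ :∩ x₀) x₀ [])
        d' d' (trans (setSolve (I ∷ᵥ J ∷ᵥ []ᵥ) [] (x₁ :∪ x₀) (x₀ :∪ x₁) []) u)
        where
        d' : Disjoint J I
        d' = setSolve (I ∷ᵥ J ∷ᵥ []ᵥ) ((x₀ :∩ x₁ :≡ :∅) ∷ []) (x₁ :∩ x₀) :∅ (d ∷ [])

      -- Cutting b trivially as (∅, J) puts all of it on the side of B; (D1) for (I, J) and (A, B ∪
      -- J) then merges the pieces.
      dec-assoc : ∀ {I J A B Ω a b x} → Comp I J Ω a b x → IsDec A B I a → IsDec A (B ∪ J) Ω x
      dec-assoc {I} {J} {A} {B} {Ω} {a} {b} h@(mkComp d u _) ab@(_ , _ , mkComp d' u' _) =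
        dec-merge h ab (isDec-unitˡ b)
          (setSolve ρ hs (x₀ :∩ x₂) x₂ ps) (setSolve ρ hs (x₀ :∩ (x₃ :∪ x₁)) x₃ ps)
          (setSolve ρ hs (x₁ :∩ x₂) :∅ ps) (setSolve ρ hs (x₁ :∩ (x₃ :∪ x₁)) x₁ ps)
          (setSolve ρ hs (x₂ :∩ (x₃ :∪ x₁)) :∅ ps)
          (trans (setSolve ρ hs (x₂ :∪ (x₃ :∪ x₁)) (x₀ :∪ x₁) ps) u)
        where
        ρ = I ∷ᵥ J ∷ᵥ A ∷ᵥ B ∷ᵥ []ᵥ
        hs = (x₀ :∩ x₁ :≡ :∅) ∷ (x₂ :∩ x₃ :≡ :∅) ∷ (x₂ :∪ x₃ :≡ x₀) ∷ []
        ps = d ∷ d' ∷ u' ∷ []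

      dec-∩ : ∀ {I J K L Ω x} → IsDec I J Ω x → IsDec K L Ω x → IsDec (I ∩ K) ((I ∩ L) ∪ J) Ω x
      dec-∩ (a , b , h) k = dec-assoc h (proj₁ (dec-split h k))

      -- An indecomposable part cannot be cut by another decomposition.
      atom-⊆ : ∀ {I J K L Ω a b x i m} → Comp I J Ω a b x → IsIndecomposable N I a → IsDec K L Ω x →
               mem I i m ≡ true → mem K i m ≡ true → I ∩ K ≡ I
      atom-⊆ {I} {J} {K} {L} {i = i} {m} h@(mkComp _ u _) (_ , indec) k@(_ , _ , mkComp _ u' _) m∈I m∈K
        with (I ∩ L) ≟ₒ ∅ᵣ | proj₁ (dec-split h k)
      ... | yes e | _ = setSolve (I ∷ᵥ J ∷ᵥ K ∷ᵥ L ∷ᵥ []ᵥ) ((x₀ :∪ x₁ :≡ x₂ :∪ x₃) ∷ (x₀ :∩ x₃ :≡ :∅) ∷ [])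
                          (x₀ :∩ x₂) x₀ (trans u (sym u') ∷ e ∷ [])
      ... | no ne | a' , b' , mkComp d'' u'' eq = ⊥-elim (indec (I ∩ K , I ∩ L , d'' , u'' , I∩K≢∅ , ne , a' , b' , eq))
        where
        I∩K≢∅ : I ∩ K ≢ ∅ᵣ
        I∩K≢∅ e = false≢true (trans (sym (mem-∅ i m)) (trans (sym (cong (λ A → mem A i m) e))
          (trans (mem-∩ I K i m) (cong₂ _∧_ m∈I m∈K))))

      -- Atoms: the minimal good sets

      module _ (n : Vec ℕ r) where

        CompS : (s : Subs n) → F₀ (toObj n s) → F₀ (toObj n (complement n s)) → F₀ (boxObj n) → Set
        CompS s = Comp (toObj n s) (toObj n (complement n s)) (boxObj n)

        -- By `atom-⊆`, two atoms through a common point contain each other.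
        atom-unique : ∀ {s t a b a' b' x i m} → CompS s a b x → IsIndecomposable N _ a → mem (toObj n s) i m ≡ true →
                      CompS t a' b' x → IsIndecomposable N _ a' → mem (toObj n t) i m ≡ true → s ≡ t
        atom-unique {s} {t} h ind m∈s h' ind' m∈t = toObj-injective n s t
          (setSolve (toObj n s ∷ᵥ toObj n t ∷ᵥ []ᵥ) ((x₀ :∩ x₁ :≡ x₀) ∷ (x₁ :∩ x₀ :≡ x₁) ∷ []) x₀ x₁
            (atom-⊆ h ind (_ , _ , h') m∈s m∈t ∷ atom-⊆ h' ind' (_ , _ , h) m∈t m∈s ∷ []))

        module _ (x : F₀ (boxObj n)) (i : Fin r) (m : ℕ) where

          Good : Subs n → Set
          Good s = IsDec (toObj n s) (toObj n (complement n s)) (boxObj n) x × mem (toObj n s) i m ≡ true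

          Good? : ∀ s → Dec (Good s)
          Good? s = IsDec? _ _ _ x ×-dec (mem (toObj n s) i m Boolₚ.≟ true)

          -- I and J are arbitrary objects because `dec-∩` produces them as set expressions;
          -- `fromDec` returns to `Subs n` once at the end. Shrinking I further preserves the
          -- containments already recorded in the list.
          intersection : mem (boxObj n) i m ≡ true → ∀ ss → Σ[ I ∈ Obj r ] Σ[ J ∈ Obj r ]
            IsDec I J (boxObj n) x × mem I i m ≡ true × All (λ s → Good s → I ∩ toObj n s ≡ I) ss
          intersection m∈Ω [] = boxObj n , ∅ᵣ , isDec-unitʳ x , m∈Ω , []
          intersection m∈Ω (s ∷ ss) with intersection m∈Ω ss | Good? s
          ... | I , J , h , m∈I , min | no ¬g = I , J , h , m∈I , (λ g → ⊥-elim (¬g g)) ∷ min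
          ... | I , J , h , m∈I , min | yes (g , m∈s) = I ∩ toObj n s , _ , dec-∩ h g ,
            trans (mem-∩ I (toObj n s) i m) (cong₂ _∧_ m∈I m∈s) ,
            (λ _ → setSolve (I ∷ᵥ toObj n s ∷ᵥ []ᵥ) [] ((x₀ :∩ x₁) :∩ x₁) (x₀ :∩ x₁) []) ∷
            All.map (λ {t} f g → setSolve (I ∷ᵥ toObj n s ∷ᵥ toObj n t ∷ᵥ []ᵥ) ((x₀ :∩ x₂ :≡ x₀) ∷ [])
              ((x₀ :∩ x₁) :∩ x₂) (x₀ :∩ x₁) (f g ∷ [])) min

          fromDec : ∀ {I J} → IsDec I J (boxObj n) x → Σ[ s ∈ Subs n ] toObj n s ≡ I × toObj n (complement n s) ≡ J
          fromDec {I} {J} (_ , _ , mkComp d u _) with toObj-surjective n I J u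
          -- The complement of a part within the box is unique, so J must be the encoded one.
          ... | s , refl = s , refl , setSolve (toObj n s ∷ᵥ toObj n (complement n s) ∷ᵥ J ∷ᵥ []ᵥ)
            ((x₀ :∩ x₁ :≡ :∅) ∷ (x₀ :∩ x₂ :≡ :∅) ∷ (x₀ :∪ x₁ :≡ x₀ :∪ x₂) ∷ []) x₁ x₂
            (toObj-disjoint n s ∷ d ∷ trans (toObj-∪ n s) (sym u) ∷ [])

          -- The intersection of all good sets is good, and minimality makes its part of x indecomposable.
          atom-exists : mem (boxObj n) i m ≡ true → Σ[ s ∈ Subs n ] Σ[ a ∈ _ ] Σ[ b ∈ _ ]
            CompS s a b x × IsIndecomposable N (toObj n s) a × mem (toObj n s) i m ≡ true
          atom-exists m∈Ω with intersection m∈Ω (allSubs n)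
          ... | I , J , h , m∈I , min with fromDec h
          ... | s , refl , refl with h
          ... | a , b , h′ = s , a , b , h′ , (nonempty , indec) , m∈I
            where
            nonempty : toObj n s ≢ ∅ᵣ
            nonempty e = false≢true (trans (sym (mem-∅ i m)) (trans (sym (cong (λ A → mem A i m) e)) m∈I))

            minimal : ∀ {K L} → IsDec K L (boxObj n) x → mem K i m ≡ true → toObj n s ∩ K ≡ toObj n s
            minimal k m∈K with fromDec k
            ... | t , refl , refl = All.lookup min (∈-allSubs n t) (k , m∈K)

            indec : ¬ (Σ[ A ∈ Obj r ] Σ[ B ∈ Obj r ] Σ[ d ∈ Disjoint A B ] Σ[ p ∈ A ∪ B ≡ toObj n s ]
                      (A ≢ ∅ᵣ) × (B ≢ ∅ᵣ) × (Σ[ a' ∈ F₀ A ] Σ[ b' ∈ F₀ B ] subst F₀ p (η A B d a' b') ≡ a))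
            -- The marked point lies in A or in B. That side is good, hence by minimality is the
            -- whole part, and the other side is empty. If it is B, `dec-comm` first brings B to the
            -- front for `dec-assoc`.
            indec (A , B , d , p , A≢∅ , B≢∅ , a' , b' , e) with T? (mem A i m)
            ... | inj₁ t = B≢∅ (setSolve (A ∷ᵥ B ∷ᵥ toObj n s ∷ᵥ []ᵥ)
                  ((x₀ :∩ x₁ :≡ :∅) ∷ (x₀ :∪ x₁ :≡ x₂) ∷ (x₂ :∩ x₀ :≡ x₂) ∷ []) x₁ :∅
                  (d ∷ p ∷ minimal (dec-assoc h′ (a' , b' , mkComp d p e)) (T-true t) ∷ []))
            ... | inj₂ f = A≢∅ (setSolve (A ∷ᵥ B ∷ᵥ toObj n s ∷ᵥ []ᵥ)
                  ((x₀ :∩ x₁ :≡ :∅) ∷ (x₀ :∪ x₁ :≡ x₂) ∷ (x₂ :∩ x₁ :≡ x₂) ∷ []) x₀ :∅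
                  (d ∷ p ∷ minimal (dec-assoc h′ (dec-comm (a' , b' , mkComp d p e)))
                    (trans (cong (_∨ mem B i m) (sym f)) (trans (sym (mem-∪ A B i m)) (trans (cong (λ A → mem A i m) p) m∈I))) ∷ []))

-- Counting

points : ∀ {r} → Vec ℕ r → List (Fin r × ℕ)
points []ᵥ       = []
points (n ∷ᵥ ns) = List.map (λ m → zero , suc m) (upTo n) ++ List.map (λ (i , m) → suc i , m) (points ns)

-- Sums with one nonzero term, and counting of points

module Selection {c ℓ : Level} (Λ : CommutativeRing c ℓ) (ι : ℚ → CommutativeRing.Carrier Λ) where
  open CommutativeRing Λ hiding (zero)
  open SetoidReasoning setoid
  open FiniteSums Λ
  open PowerSeries Λ ι using (total)

  if-false : ∀ {b} {x : Carrier} → ¬ T b → (if b then x else 0#) ≈ 0#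
  if-false {true}  ¬t = ⊥-elim (¬t tt)
  if-false {false} ¬t = refl

  if-true : ∀ {b} {x : Carrier} → T b → (if b then x else 0#) ≈ x
  if-true {true} t = refl

  if-no : ∀ {P : Set} (P? : Dec P) {x : Carrier} → ¬ P → (if ⌊ P? ⌋ then x else 0#) ≈ 0#
  if-no (yes p) ¬p = ⊥-elim (¬p p)
  if-no (no _)  ¬p = refl

  if-yes : ∀ {P : Set} (P? : Dec P) {x : Carrier} → P → (if ⌊ P? ⌋ then x else 0#) ≈ x
  if-yes (yes _) p = refl
  if-yes (no ¬p) p = ⊥-elim (¬p p)

  if-cong : ∀ b {x y : Carrier} → x ≈ y → (if b then x else 0#) ≈ (if b then y else 0#)
  if-cong true  e = e
  if-cong false e = refl

  ∑-tabulate-zero : ∀ {A : Set} {n} (h : Fin n → A) f → (∀ i → f (h i) ≈ 0#) → ∑ (List.tabulate h) f ≈ 0#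
  ∑-tabulate-zero {n = zero}  h f z = refl
  ∑-tabulate-zero {n = suc n} h f z =
    trans (+-cong (z zero) (∑-tabulate-zero (h ∘ suc) f (z ∘ suc))) (+-identityˡ 0#)

  ∑-tabulate-single : ∀ {A : Set} {n} (h : Fin n → A) f k → (∀ i → i ≢ k → f (h i) ≈ 0#) →
                      ∑ (List.tabulate h) f ≈ f (h k)
  ∑-tabulate-single h f zero    z =
    trans (+-congˡ (∑-tabulate-zero (h ∘ suc) f (λ i → z (suc i) (λ ())))) (+-identityʳ _)
  ∑-tabulate-single h f (suc k) z =
    trans (+-cong (z zero (λ ())) (∑-tabulate-single (h ∘ suc) f k (λ i ne → z (suc i) (λ { ≡.refl → ne ≡.refl }))))
      (+-identityˡ _)

  ∑-allBits-single : ∀ {n} (f : Vec Bool n → Carrier) v → (∀ u → u ≢ v → f u ≈ 0#) → ∑ (allBits n) f ≈ f v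
  ∑-allBits-single f []ᵥ z = +-identityʳ _
  ∑-allBits-single {suc n} f (true ∷ᵥ v) z = begin
    ∑ (allBits (suc n)) f
      ≈⟨ ∑-++ (List.map (true ∷ᵥ_) (allBits n)) _ f ⟩
    ∑ (List.map (true ∷ᵥ_) (allBits n)) f + ∑ (List.map (false ∷ᵥ_) (allBits n)) f
      ≈⟨ +-cong (∑-map (true ∷ᵥ_) (allBits n) f) (∑-map (false ∷ᵥ_) (allBits n) f) ⟩
    ∑ (allBits n) (f ∘ (true ∷ᵥ_)) + ∑ (allBits n) (f ∘ (false ∷ᵥ_))
      ≈⟨ +-cong (∑-allBits-single (f ∘ (true ∷ᵥ_)) v (λ u ne → z _ (λ { ≡.refl → ne ≡.refl })))
                (∑-zero (allBits n) (λ u → z _ (λ ()))) ⟩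
    f (true ∷ᵥ v) + 0#
      ≈⟨ +-identityʳ _ ⟩
    f (true ∷ᵥ v) ∎
  ∑-allBits-single {suc n} f (false ∷ᵥ v) z = begin
    ∑ (allBits (suc n)) f
      ≈⟨ ∑-++ (List.map (true ∷ᵥ_) (allBits n)) _ f ⟩
    ∑ (List.map (true ∷ᵥ_) (allBits n)) f + ∑ (List.map (false ∷ᵥ_) (allBits n)) f
      ≈⟨ +-cong (∑-map (true ∷ᵥ_) (allBits n) f) (∑-map (false ∷ᵥ_) (allBits n) f) ⟩
    ∑ (allBits n) (f ∘ (true ∷ᵥ_)) + ∑ (allBits n) (f ∘ (false ∷ᵥ_))
      ≈⟨ +-cong (∑-zero (allBits n) (λ u → z _ (λ ())))
                (∑-allBits-single (f ∘ (false ∷ᵥ_)) v (λ u ne → z _ (λ { ≡.refl → ne ≡.refl }))) ⟩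
    0# + f (false ∷ᵥ v)
      ≈⟨ +-identityˡ _ ⟩
    f (false ∷ᵥ v) ∎

  ∑-allSubs-single : ∀ {r} (n : Vec ℕ r) (f : Subs n → Carrier) s → (∀ t → t ≢ s → f t ≈ 0#) →
                     ∑ (allSubs n) f ≈ f s
  ∑-allSubs-single []ᵥ       f tt      z = +-identityʳ _
  ∑-allSubs-single (n ∷ᵥ ns) f (v , s) z = begin
    ∑ (allSubs (n ∷ᵥ ns)) f
      ≈⟨ ∑-concatMap (λ u → List.map (u ,_) (allSubs ns)) (allBits n) f ⟩
    ∑ (allBits n) (λ u → ∑ (List.map (u ,_) (allSubs ns)) f)
      ≈⟨ ∑-cong (allBits n) (λ u → ∑-map (u ,_) (allSubs ns) f) ⟩
    ∑ (allBits n) (λ u → ∑ (allSubs ns) (λ t → f (u , t)))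
      ≈⟨ ∑-allBits-single _ v (λ u ne → ∑-zero (allSubs ns) (λ t → z _ (λ { ≡.refl → ne ≡.refl }))) ⟩
    ∑ (allSubs ns) (λ t → f (v , t))
      ≈⟨ ∑-allSubs-single ns _ s (λ t ne → z _ (λ { ≡.refl → ne ≡.refl })) ⟩
    f (v , s) ∎

  ∑<-bits : ∀ {n} (v : Vec Bool n) x → ∑< n (λ m → if bitAt (toList v) m then x else 0#) ≈ nat (ones (toList v)) * x
  ∑<-bits []ᵥ          x = sym (zeroˡ x)
  ∑<-bits (true  ∷ᵥ v) x = trans (+-cong (sym (*-identityˡ x)) (∑<-bits v x)) (sym (distribʳ _ _ _))
  ∑<-bits (false ∷ᵥ v) x = trans (+-identityˡ _) (∑<-bits v x)

  ∑-points : ∀ {r} (n : Vec ℕ r) s x →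
    ∑ (points n) (λ (i , m) → if mem (toObj n s) i m then x else 0#) ≈ nat (total (sizes n s)) * x
  ∑-points []ᵥ       tt      x = sym (zeroˡ x)
  ∑-points (n ∷ᵥ ns) (v , s) x = begin
    ∑ (points (n ∷ᵥ ns)) F
      ≈⟨ ∑-++ (List.map (λ m → zero , suc m) (upTo n)) _ F ⟩
    ∑ (List.map (λ m → zero , suc m) (upTo n)) F + ∑ (List.map (λ (i , m) → suc i , m) (points ns)) F
      ≈⟨ +-cong (∑-map _ (upTo n) F) (∑-map _ (points ns) F) ⟩
    ∑ (upTo n) (λ m → if suc m ∈? box v then x else 0#) + ∑ (points ns) (λ (i , m) → if mem (toObj ns s) i m then x else 0#)
      ≈⟨ +-cong (trans (∑<-applyUpTo n id _) (∑<-cong n (λ m → reflexive (≡.cong (λ b → if b then x else 0#) (∈-box v (suc m))))))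
                (∑-points ns s x) ⟩
    ∑< n (λ m → if bitAt (toList v) m then x else 0#) + nat (total (sizes ns s)) * x
      ≈⟨ +-congʳ (∑<-bits v x) ⟩
    nat (ones (toList v)) * x + nat (total (sizes ns s)) * x
      ≈⟨ distribʳ _ _ _ ⟨
    (nat (ones (toList v)) + nat (total (sizes ns s))) * x
      ≈⟨ *-congʳ (nat-+ (ones (toList v)) _) ⟨
    nat (total (sizes (n ∷ᵥ ns) (v , s))) * x ∎
    where
    F : Fin _ × ℕ → Carrier
    F (i , m) = if mem (toObj (n ∷ᵥ ns) (v , s)) i m then x else 0#

-- Weighted sums over structures and their recurrence

module Counting {r : ℕ} {S : Species r} (N : NatTrans S) (D1 : IsCompositionOperator N) (point : Species.F₀ S ∅ᵣ)
                {c ℓ : Level} (Λ : CommutativeRing c ℓ) (ι : ℚ → CommutativeRing.Carrier Λ)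
                (ι-mono : RingMorphisms.IsRingMonomorphism +-*-rawRing (CommutativeRing.rawRing Λ) ι)
                (W : Weight N Λ) (χ : (Ω : Obj r) → Species.F₀ S Ω → Bool)
                (χ⇔ : ∀ Ω x → T (χ Ω x) ⇔ IsIndecomposable N Ω x) where
  open Species S
  open NatTrans N
  open CommutativeRing Λ hiding (zero)
  open SetoidReasoning setoid
  open FiniteSums Λ
  open PowerSeries Λ ι
  open Exponential Λ ι ι-mono
  open Selection Λ ι
  open Decompositions N
  open Weight W
  open CommutativeSemigroupProperties *-commutativeSemigroup using (x∙yz≈y∙xz)
  open SemiringSolver commutativeSemiring using (solve; _:*_; _:=_)

  abstract
    -- Kept opaque, so that everything below rests on these laws and not on the chosen enumeration;
    -- `weightedSum-∑F` is the link to the coefficients of the series.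
    ∑F : (Ω : Obj r) → (F₀ Ω → Carrier) → Carrier
    ∑F Ω f = ∑ (allFin (card Ω)) (f ∘ Inverse.from (enum Ω))

    ∑F-cong : ∀ Ω {f g : F₀ Ω → Carrier} → (∀ x → f x ≈ g x) → ∑F Ω f ≈ ∑F Ω g
    ∑F-cong Ω e = ∑-cong (allFin (card Ω)) (λ i → e _)

    ∑F-zero : ∀ Ω {f : F₀ Ω → Carrier} → (∀ x → f x ≈ 0#) → ∑F Ω f ≈ 0#
    ∑F-zero Ω e = ∑-zero (allFin (card Ω)) (λ i → e _)

    ∑F-*ˡ : ∀ Ω a (f : F₀ Ω → Carrier) → ∑F Ω (λ x → a * f x) ≈ a * ∑F Ω f
    ∑F-*ˡ Ω a f = ∑-*ˡ (allFin (card Ω)) a _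

    ∑F-*ʳ : ∀ Ω (f : F₀ Ω → Carrier) a → ∑F Ω (λ x → f x * a) ≈ ∑F Ω f * a
    ∑F-*ʳ Ω f a = ∑-*ʳ (allFin (card Ω)) _ a

    ∑F-∑ : ∀ Ω {A : Set} (xs : List A) (f : F₀ Ω → A → Carrier) →
           ∑F Ω (λ x → ∑ xs (f x)) ≈ ∑ xs (λ a → ∑F Ω (λ x → f x a))
    ∑F-∑ Ω xs f = ∑-swap (allFin (card Ω)) xs _

    ∑F-∑F : ∀ Ω Ω' (f : F₀ Ω → F₀ Ω' → Carrier) →
            ∑F Ω (λ x → ∑F Ω' (f x)) ≈ ∑F Ω' (λ y → ∑F Ω (λ x → f x y))
    ∑F-∑F Ω Ω' f = ∑-swap (allFin (card Ω)) (allFin (card Ω')) _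

    ∑F-single : ∀ Ω (f : F₀ Ω → Carrier) y → (∀ x → x ≢ y → f x ≈ 0#) → ∑F Ω f ≈ f y
    ∑F-single Ω f y z = trans
      (∑-tabulate-single id (f ∘ from) (to y)
        (λ i ne → z (from i) (λ e → ne (≡.trans (≡.sym (strictlyInverseˡ i)) (≡.cong to e)))))
      (reflexive (≡.cong f (strictlyInverseʳ y)))
      where open Inverse (enum Ω)

    weightedSum-∑F : ∀ Ω sel → weightedSum ι W Ω sel ≈ ∑F Ω (λ x → if sel x then w Ω x else 0#)
    weightedSum-∑F Ω sel = refl

  -- The enumerations of F[Ω] and F[Ω'] are unrelated. The change of variables therefore inserts the
  -- indicator of y = F[h](x) and evaluates the double sum in both orders.
  ∑F-hom : ∀ {Ω Ω'} (h : Hom Ω Ω') (f : F₀ Ω' → Carrier) → ∑F Ω (f ∘ F₁ h) ≈ ∑F Ω' f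
  ∑F-hom {Ω} {Ω'} h f = begin
    ∑F Ω (λ x → f (F₁ h x))
      ≈⟨ ∑F-cong Ω (λ x → trans (∑F-single Ω' _ (F₁ h x) (λ y ne → if-no (y ≟F F₁ h x) ne))
                                (if-yes (F₁ h x ≟F F₁ h x) ≡.refl)) ⟨
    ∑F Ω (λ x → ∑F Ω' (λ y → if ⌊ y ≟F F₁ h x ⌋ then f y else 0#))
      ≈⟨ ∑F-∑F Ω Ω' _ ⟩
    ∑F Ω' (λ y → ∑F Ω (λ x → if ⌊ y ≟F F₁ h x ⌋ then f y else 0#))
      ≈⟨ ∑F-cong Ω' (λ y → trans
           (∑F-single Ω _ (F₁ (symHom h) y) (λ x ne → if-no (y ≟F F₁ h x) (λ e → ne
             (≡.trans (≡.sym (F₁-inverseˡ h x)) (≡.cong (F₁ (symHom h)) (≡.sym e))))))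
           (if-yes (y ≟F F₁ h (F₁ (symHom h) y)) (≡.sym (F₁-inverseʳ h y)))) ⟩
    ∑F Ω' f ∎

  weightF weightFη : Obj r → Carrier
  weightF  Ω = ∑F Ω (w Ω)
  weightFη Ω = ∑F Ω (λ x → if χ Ω x then w Ω x else 0#)

  χ-hom : ∀ {Ω Ω'} (h : Hom Ω Ω') x → χ Ω' (F₁ h x) ≡ χ Ω x
  χ-hom {Ω} {Ω'} h x = T-≡ forth back
    where
    T-≡ : ∀ {a b} → (T a → T b) → (T b → T a) → a ≡ b
    T-≡ {true}  {true}  f g = ≡.refl
    T-≡ {true}  {false} f g = ⊥-elim (f tt)
    T-≡ {false} {true}  f g = ⊥-elim (g tt)
    T-≡ {false} {false} f g = ≡.refl

    forth : T (χ Ω' (F₁ h x)) → T (χ Ω x)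
    forth t = Equivalence.from (χ⇔ Ω x) (indecomposable-reflect h x (Equivalence.to (χ⇔ Ω' (F₁ h x)) t))

    back : T (χ Ω x) → T (χ Ω' (F₁ h x))
    back t = Equivalence.from (χ⇔ Ω' (F₁ h x)) (indecomposable-reflect (symHom h) (F₁ h x)
      (≡.subst (IsIndecomposable N Ω) (≡.sym (F₁-inverseˡ h x)) (Equivalence.to (χ⇔ Ω x) t)))

  weightF-hom : ∀ {Ω Ω'} → Hom Ω Ω' → weightF Ω ≈ weightF Ω'
  weightF-hom {Ω} {Ω'} h = trans (∑F-cong Ω (λ x → sym (W1 h x))) (∑F-hom h (w Ω'))

  weightFη-hom : ∀ {Ω Ω'} → Hom Ω Ω' → weightFη Ω ≈ weightFη Ω'
  weightFη-hom {Ω} {Ω'} h = trans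
    (∑F-cong Ω (λ x → trans (if-cong (χ Ω x) (sym (W1 h x)))
      (reflexive (≡.cong (λ b → if b then w Ω' (F₁ h x) else 0#) (≡.sym (χ-hom h x))))))
    (∑F-hom h (λ y → if χ Ω' y then w Ω' y else 0#))

  w-subst : ∀ {Ω Ω'} (p : Ω ≡ Ω') x → w Ω' (≡.subst F₀ p x) ≈ w Ω x
  w-subst ≡.refl x = refl

  module _ (n : Vec ℕ r) where

    private
      Ω : Obj r
      Ω = boxObj n

      part rest : Subs n → Obj r
      part s = toObj n s
      rest s = toObj n (complement n s)

    -- Membership of the point and χ come first because neither involves x: `∑F-isAtom` settles them
    -- before it sums over x.
    isAtom : ∀ s → F₀ (part s) → F₀ (rest s) → F₀ Ω → Fin r × ℕ → Bool
    isAtom s a b x (i , m) = mem (part s) i m ∧ (χ (part s) a ∧ ⌊ Comp? (part s) (rest s) Ω a b x ⌋)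

    isAtom-sound : ∀ s a b x i m → T (isAtom s a b x (i , m)) →
      CompS D1 point n s a b x × IsIndecomposable N (part s) a × mem (part s) i m ≡ true
    isAtom-sound s a b x i m t =
      let m∈s , t′ = T-∧ (mem (part s) i m) t
          χa , h = T-∧ (χ (part s) a) t′
      in toWitness h , Equivalence.to (χ⇔ (part s) a) χa , T-true m∈s

    isAtom-complete : ∀ {s a b x i m} → CompS D1 point n s a b x → IsIndecomposable N (part s) a →
      mem (part s) i m ≡ true → T (isAtom s a b x (i , m))
    isAtom-complete {s} {a} {b} {x} h ind m∈s =
      T-∧⁺ (≡.subst T (≡.sym m∈s) tt) (T-∧⁺ (Equivalence.from (χ⇔ (part s) a) ind) (fromWitness h))
      where
      T-∧⁺ : ∀ {a b} → T a → T b → T (a ∧ b)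
      T-∧⁺ {true} _ t = t

    atoms : F₀ Ω → Fin r × ℕ → Carrier
    atoms x p = ∑ (allSubs n) λ s → ∑F (part s) λ a → ∑F (rest s) λ b → if isAtom s a b x p then w Ω x else 0#

    -- Exactly one atom of x contains a given point of Ω.
    ∑-atoms : ∀ x p → atoms x p ≈ (if mem Ω (proj₁ p) (proj₂ p) then w Ω x else 0#)
    ∑-atoms x (i , m) with mem Ω i m in m∈Ω
    ... | false = ∑-zero (allSubs n) λ s → ∑F-zero (part s) λ a → ∑F-zero (rest s) λ b → if-false λ t →
            let _ , _ , m∈s = isAtom-sound s a b x i m t in
            false≢true (≡.trans (≡.sym m∈Ω) (≡.trans (≡.sym (≡.cong (λ A → mem A i m) (toObj-∪ n s)))
              (≡.trans (mem-∪ (part s) (rest s) i m) (≡.cong (_∨ mem (rest s) i m) m∈s))))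
    ... | true  =
      let s , a , b , h , ind , m∈s = atom-exists D1 point n x i m m∈Ω
          unique : ∀ t a′ b′ → T (isAtom t a′ b′ x (i , m)) → t ≡ s
          unique t a′ b′ hit = let h′ , ind′ , m∈t = isAtom-sound t a′ b′ x i m hit in
            atom-unique D1 point n h′ ind′ m∈t h ind m∈s
      in begin
        atoms x (i , m)
          ≈⟨ ∑-allSubs-single n _ s (λ t ne → ∑F-zero (part t) λ a′ → ∑F-zero (rest t) λ b′ →
               if-false (λ hit → ne (unique t a′ b′ hit))) ⟩
        (∑F (part s) λ a′ → ∑F (rest s) λ b′ → if isAtom s a′ b′ x (i , m) then w Ω x else 0#)
          ≈⟨ ∑F-single (part s) _ a (λ a′ ne → ∑F-zero (rest s) λ b′ → if-false λ hit →
               ne (proj₁ (comp-injective (proj₁ (isAtom-sound s a′ b′ x i m hit)) h))) ⟩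
        (∑F (rest s) λ b′ → if isAtom s a b′ x (i , m) then w Ω x else 0#)
          ≈⟨ ∑F-single (rest s) _ b (λ b′ ne → if-false λ hit →
               ne (proj₂ (comp-injective (proj₁ (isAtom-sound s a b′ x i m hit)) h))) ⟩
        (if isAtom s a b x (i , m) then w Ω x else 0#)
          ≈⟨ if-true (isAtom-complete h ind m∈s) ⟩
        w Ω x ∎

    -- For fixed a and b exactly one x contributes, namely η(a, b), and (W2) applies as a is
    -- indecomposable.
    ∑F-comp : ∀ s a b → IsIndecomposable N (part s) a →
      ∑F Ω (λ x → if ⌊ Comp? (part s) (rest s) Ω a b x ⌋ then w Ω x else 0#) ≈ w (part s) a * w (rest s) b
    ∑F-comp s a b ind = begin
      ∑F Ω (λ x → if ⌊ Comp? (part s) (rest s) Ω a b x ⌋ then w Ω x else 0#)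
        ≈⟨ ∑F-single Ω _ y (λ x ne → if-no (Comp? _ _ Ω a b x) λ h → ne (comp-functional h y-comp)) ⟩
      (if ⌊ Comp? (part s) (rest s) Ω a b y ⌋ then w Ω y else 0#)
        ≈⟨ if-yes (Comp? _ _ Ω a b y) y-comp ⟩
      w Ω y
        ≈⟨ w-subst (toObj-∪ n s) _ ⟩
      w (part s ∪ rest s) (η (part s) (rest s) (toObj-disjoint n s) a b)
        ≈⟨ W2 (toObj-disjoint n s) a b ind ⟩
      w (part s) a * w (rest s) b ∎
      where
      y = ≡.subst F₀ (toObj-∪ n s) (η (part s) (rest s) (toObj-disjoint n s) a b)

      y-comp : Comp (part s) (rest s) Ω a b y
      y-comp = mkComp (toObj-disjoint n s) (toObj-∪ n s) ≡.refl

    ∑F-isAtom : ∀ s a b p → ∑F Ω (λ x → if isAtom s a b x p then w Ω x else 0#) ≈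
      (if mem (part s) (proj₁ p) (proj₂ p) then (if χ (part s) a then w (part s) a else 0#) * w (rest s) b else 0#)
    ∑F-isAtom s a b (i , m) with mem (part s) i m | χ (part s) a in χa
    ... | false | _     = ∑F-zero Ω (λ _ → refl)
    ... | true  | false = trans (∑F-zero Ω (λ _ → refl)) (sym (zeroˡ _))
    ... | true  | true  = ∑F-comp s a b (Equivalence.to (χ⇔ (part s) a) (≡.subst T (≡.sym χa) tt))

    -- With the sum over x innermost, the indicator collapses to a product of weights. The sum over
    -- points then sees only membership in the part and yields its size.
    ∑-per-part : ∀ s →
      ∑F Ω (λ x → ∑ (points n) λ p → ∑F (part s) λ a → ∑F (rest s) λ b → if isAtom s a b x p then w Ω x else 0#) ≈
      nat (total (sizes n s)) * (weightFη (part s) * weightF (rest s))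
    ∑-per-part s = begin
      (∑F Ω λ x → ∑ (points n) λ p → ∑F (part s) λ a → ∑F (rest s) λ b → if isAtom s a b x p then w Ω x else 0#)
        ≈⟨ ∑F-∑ Ω (points n) _ ⟩
      (∑ (points n) λ p → ∑F Ω λ x → ∑F (part s) λ a → ∑F (rest s) λ b → if isAtom s a b x p then w Ω x else 0#)
        ≈⟨ ∑-cong (points n) (λ p → trans (∑F-∑F Ω (part s) _) (∑F-cong (part s) (λ a →
             trans (∑F-∑F Ω (rest s) _) (∑F-cong (rest s) (λ b → ∑F-isAtom s a b p))))) ⟩
      (∑ (points n) λ p → ∑F (part s) λ a → ∑F (rest s) λ b → if mem (part s) (proj₁ p) (proj₂ p) then V a * w (rest s) b else 0#)
        ≈⟨ ∑F-∑ (part s) (points n) _ ⟨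
      (∑F (part s) λ a → ∑ (points n) λ p → ∑F (rest s) λ b → if mem (part s) (proj₁ p) (proj₂ p) then V a * w (rest s) b else 0#)
        ≈⟨ ∑F-cong (part s) (λ a → ∑F-∑ (rest s) (points n) _) ⟨
      (∑F (part s) λ a → ∑F (rest s) λ b → ∑ (points n) λ p → if mem (part s) (proj₁ p) (proj₂ p) then V a * w (rest s) b else 0#)
        ≈⟨ ∑F-cong (part s) (λ a → ∑F-cong (rest s) (λ b → ∑-points n s _)) ⟩
      (∑F (part s) λ a → ∑F (rest s) λ b → nat (total (sizes n s)) * (V a * w (rest s) b))
        ≈⟨ ∑F-cong (part s) (λ a → trans (∑F-*ˡ (rest s) _ _) (*-congˡ (∑F-*ˡ (rest s) _ _))) ⟩
      (∑F (part s) λ a → nat (total (sizes n s)) * (V a * weightF (rest s)))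
        ≈⟨ trans (∑F-*ˡ (part s) _ _) (*-congˡ (∑F-*ʳ (part s) V (weightF (rest s)))) ⟩
      nat (total (sizes n s)) * (weightFη (part s) * weightF (rest s)) ∎
      where
      V : F₀ (part s) → Carrier
      V a = if χ (part s) a then w (part s) a else 0#

    -- Count pairs (x, p) of a structure x ∈ F[Ω] and a point p of Ω by the atom of x that contains p.
    weightF-recurrence : nat (total n) * weightF Ω ≈
      ∑ (allSubs n) (λ s → nat (total (sizes n s)) * (weightFη (boxObj (sizes n s)) * weightF (boxObj (sizes n (complement n s)))))
    weightF-recurrence = begin
      nat (total n) * weightF Ω
        ≈⟨ ∑F-*ˡ Ω _ _ ⟨
      ∑F Ω (λ x → nat (total n) * w Ω x)
        ≈⟨ ∑F-cong Ω (λ x → all-points (w Ω x)) ⟨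
      (∑F Ω λ x → ∑ (points n) λ p → if mem Ω (proj₁ p) (proj₂ p) then w Ω x else 0#)
        ≈⟨ ∑F-cong Ω (λ x → ∑-cong (points n) (∑-atoms x)) ⟨
      (∑F Ω λ x → ∑ (points n) λ p → atoms x p)
        ≈⟨ ∑F-cong Ω (λ x → ∑-swap (points n) (allSubs n) _) ⟩
      (∑F Ω λ x → ∑ (allSubs n) λ s → ∑ (points n) λ p → ∑F (part s) λ a → ∑F (rest s) λ b → if isAtom s a b x p then w Ω x else 0#)
        ≈⟨ ∑F-∑ Ω (allSubs n) _ ⟩
      (∑ (allSubs n) λ s → ∑F Ω λ x → ∑ (points n) λ p → ∑F (part s) λ a → ∑F (rest s) λ b → if isAtom s a b x p then w Ω x else 0#)
        ≈⟨ ∑-cong (allSubs n) (λ s → trans (∑-per-part s)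
             (*-congˡ (*-cong (weightFη-hom (toObjHom n s)) (weightF-hom (toObjHom n (complement n s)))))) ⟩
      ∑ (allSubs n) (λ s → nat (total (sizes n s)) * (weightFη (boxObj (sizes n s)) * weightF (boxObj (sizes n (complement n s))))) ∎
      where
      -- The box is its own subobject `full n`, so `∑-points` counts its points too.
      all-points : ∀ y → ∑ (points n) (λ p → if mem Ω (proj₁ p) (proj₂ p) then y else 0#) ≈ nat (total n) * y
      all-points y = ≡.subst₂ (λ A k → ∑ (points n) (λ p → if mem A (proj₁ p) (proj₂ p) then y else 0#) ≈ nat (total k) * y)
        (toObj-full n) (sizes-full n) (∑-points n (full n) y)

  -- The differential equation and the constant terms of the generating functions

  GF-weightF : ∀ n → GF ι W n ≈ invMultiFact n * weightF (boxObj n)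
  GF-weightF n = *-congˡ (weightedSum-∑F (boxObj n) (λ _ → true))

  GFη-weightFη : ∀ n → GFη ι W χ n ≈ invMultiFact n * weightFη (boxObj n)
  GFη-weightFη n = *-congˡ (weightedSum-∑F (boxObj n) (χ (boxObj n)))

  -- The terms of the recurrence depend only on the sizes of the two parts, so division by the
  -- factorials turns the sum over subobjects into a product of exponential series.
  euler-GF : ∀ n → euler (GF ι W) n ≈ conv n (λ i j → euler (GFη ι W χ) i * GF ι W j)
  euler-GF n = begin
    nat (total n) * GF ι W n
      ≈⟨ *-congˡ (GF-weightF n) ⟩
    nat (total n) * (invMultiFact n * weightF (boxObj n))
      ≈⟨ x∙yz≈y∙xz _ _ _ ⟩
    invMultiFact n * (nat (total n) * weightF (boxObj n))
      ≈⟨ *-congˡ (weightF-recurrence n) ⟩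
    invMultiFact n * ∑ (allSubs n) (λ s → φ (sizes n s) (sizes n (complement n s)))
      ≈⟨ ∑-allSubs n φ ⟩
    conv n (λ i j → (invMultiFact i * invMultiFact j) * φ i j)
      ≈⟨ conv-cong n (λ i j _ → trans
           (solve 5 (λ a b c d e → (a :* b) :* (c :* (d :* e)) := (c :* (a :* d)) :* (b :* e)) refl _ _ _ _ _)
           (sym (*-cong (*-congˡ (GFη-weightFη i)) (GF-weightF j)))) ⟩
    conv n (λ i j → euler (GFη ι W χ) i * GF ι W j) ∎
    where
    φ : Vec ℕ r → Vec ℕ r → Carrier
    φ i j = nat (total i) * (weightFη (boxObj i) * weightF (boxObj j))

  boxObj-∅ : ∀ {k} (n : Vec ℕ k) → total n ≡ 0 → boxObj n ≡ ∅ᵣ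
  boxObj-∅ []ᵥ          e = ≡.refl
  boxObj-∅ (zero ∷ᵥ ns) e = ≡.cong (_ ∷ᵥ_) (boxObj-∅ ns e)

  GFη-constant : ∀ n → total n ≡ 0 → GFη ι W χ n ≈ 0#
  GFη-constant n tn = trans (GFη-weightFη n) (trans (*-congˡ (∑F-zero (boxObj n) (λ x → if-false (λ t →
    proj₁ (Equivalence.to (χ⇔ (boxObj n) x) t) (boxObj-∅ n tn))))) (zeroʳ _))

  invMultiFact-constant : ∀ {k} (n : Vec ℕ k) → total n ≡ 0 → invMultiFact n ≈ 1#
  invMultiFact-constant []ᵥ          e = refl
  invMultiFact-constant (zero ∷ᵥ ns) e =
    trans (*-cong invFact0 (invMultiFact-constant ns e)) (*-identityˡ 1#)

  weightF-∅ : weightF ∅ᵣ ≈ 1#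
  weightF-∅ = trans
    (∑F-single ∅ᵣ (w ∅ᵣ) point (λ x ne → ⊥-elim (ne (F∅-unique D1 point x))))
    (W0 point)

  GF-constant : ∀ n → total n ≡ 0 → GF ι W n ≈ 1#
  GF-constant n tn = begin
    GF ι W n                             ≈⟨ GF-weightF n ⟩
    invMultiFact n * weightF (boxObj n)  ≈⟨ *-cong (invMultiFact-constant n tn)
                                              (reflexive (≡.cong weightF (boxObj-∅ n tn))) ⟩
    1# * weightF ∅ᵣ                      ≈⟨ *-identityˡ _ ⟩
    weightF ∅ᵣ                           ≈⟨ weightF-∅ ⟩
    1#                                   ∎

  GF≈exp-GFη : ∀ n → GF ι W n ≈ exp (GFη ι W χ) n
  GF≈exp-GFη = exp-unique (GFη ι W χ) GFη-constant (GF ι W) GF-constant euler-GF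

theorem2p1 : (r : ℕ) → 1 ≤ r →
    (S : Species r) (N : NatTrans S) →
    Decomposable S → IsCompositionOperator N →
    {c ℓ : Level} (Λ : CommutativeRing c ℓ)
    (ι : ℚ → CommutativeRing.Carrier Λ) →
    RingMorphisms.IsRingMonomorphism +-*-rawRing (CommutativeRing.rawRing Λ) ι →
    (W : Weight N Λ) →
    (χ : (Ω : Obj r) → Species.F₀ S Ω → Bool) →
    (∀ Ω x → T (χ Ω x) ⇔ IsIndecomposable N Ω x) →
    ∀ (n : Vec ℕ r) →
    CommutativeRing._≈_ Λ (GF ι W n) (PowerSeries.exp Λ ι (GFη ι W χ) n)
theorem2p1 r _ S N (inhabited , _) D1 Λ ι ι-mono W χ χ⇔ =
  Counting.GF≈exp-GFη N D1 (Decompositions.F∅-inhabited N D1 inhabited) Λ ι ι-mono W χ χ⇔
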